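{- Let $p \ge 7$ be a prime. The following four conditions are equivalent: (a) $\binom{2p-1}{p-1} \equiv 1 \pmod{p^5}$; (b) $1+\frac{1}{2}+\frac{1}{3}+\cdots+\frac{1}{p-1} \equiv 0 \pmod{p^4}$; (c) $1+\frac{1}{2^2}+\frac{1}{3^2}+\cdots+\frac{1}{(p-1)^2} \equiv 0 \pmod{p^3}$; (d) $p^2 \mid B_{p^3-p^2-2}$, where $B_k$ denotes the $k$-th Bernoulli number.
   Context: In (b) and (c), $\frac{1}{k}$ (resp. $\frac{1}{k^2}$) for $1\le k\le p-1$ denotes the multiplicative inverse of $k$ (resp. $k^2$) modulo the relevant prime power ($p^4$ in (b), $p^3$ in (c)); equivalently, the congruences can be read for the rational sums, whose denominators are prime to $p$. The Bernoulli numbers $B_k$ are the rational numbers defined by $\frac{t}{e^t-1}=\sum_{k\ge 0} B_k \frac{t^k}{k!}$. For a rational number $x$ whose denominator is prime to $p$, $p^2 \mid x$ means that the numerator of $x$ (in lowest terms) is divisible by $p^2$. -}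

module Defs where

open import Data.Nat using (ℕ; zero; suc)
open import Data.Nat.Combinatorics using (_C_)
open import Data.Integer using (ℤ; +_)
open import Data.List using (List; []; _∷_; reverse; zip; upTo; map; foldr)
open import Data.Product using (_,_)
open import Data.Rational using (ℚ; 0ℚ; 1ℚ; _+_; _*_; -_; _/_)

powℚ : ℚ → ℕ → ℚ
powℚ q zero    = 1ℚ
powℚ q (suc r) = q * powℚ q r

H : ℕ → ℕ → ℚ
H r zero    = 0ℚ
H r (suc n) = H r n + powℚ (+ 1 / suc n) r

-- Bernoulli numbers with t/(e^t - 1) = Σ B_k t^k / k!, i.e. B_0 = 1 and
-- Σ_{k=0}^{m} C(m+1,k) B_k = 0 for m ≥ 1, i.e. B_m = -1/(m+1) Σ_{k<m} C(m+1,k) B_k.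
-- bernRev m = [B_m, B_{m-1}, ..., B_0].
bernRev : ℕ → List ℚ
bernRev zero    = 1ℚ ∷ []
bernRev (suc m) = next ∷ prev
  where
    prev : List ℚ
    prev = bernRev m
    next : ℚ
    next = - ((+ 1 / suc (suc m)) *
             foldr _+_ 0ℚ
               (map (λ { (k , b) → (+ (suc (suc m) C k) / 1) * b })
                    (zip (upTo (suc m)) (reverse prev))))

headℚ : List ℚ → ℚ
headℚ []      = 0ℚ
headℚ (x ∷ _) = x

bernoulli : ℕ → ℚ
bernoulli n = headℚ (bernRev n)

module Submission where

-- Write H r for Σ_{k<p} k^(-r), and work in the localisation of ℤ at p.  All conditions
-- are equivalent to p³ ∣ H 2.
-- (a) Π (1 - p/k) squares to 1, as the factors at k and p-k are inverse to each other, and it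
--     is 1 mod p, so it is 1 mod p^5.  Multiplying it into C(2p-1,p-1) = Π (1 + p/k) gives
--     Π (1 - p²/k²) ≡ 1 - p² H 2 mod p^5, because the second elementary symmetric function of
--     the 1/k² is (H 2² - H 4)/2 and both H 2 and H 4 vanish mod p.
-- (b) Pairing k with p-k and expanding 1/(p-k) in powers of p gives
--     2 H 1 ≡ -p H 2 - p² H 3 - p³ H 4 mod p^4, and likewise 2 H 3 ≡ -3p H 4 ≡ 0 mod p².
-- (d) By Euler, H r ≡ Σ_{k<p} k^(φ-r) mod p³ with φ = p³-p².  Faulhaber's formula turns this
--     power sum for r = 2 into p B_(φ-2) mod p³, once p² ∣ p B_(φ-3) and p ∣ p B_(φ-4) are
--     known; these follow in the same way from H 3 ≡ 0 mod p² and H 4 ≡ 0 mod p.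

open import Defs
open import Data.Nat using (ℕ; zero; suc; _≤_; _<_; _^_; _∸_; _*_; z≤n; s≤s; _!)
open import Data.Nat.Primality using (Prime; euclidsLemma; prime⇒irreducible; prime⇒nonZero; prime⇒nonTrivial; ¬prime[0])
open import Data.Nat.Combinatorics using (_C_; nCn≡1; nC1≡n; nCk≡nC[n∸k]; k>n⇒nCk≡0; nCk+nC[k+1]≡[n+1]C[k+1]; nCk≡n!/k![n-k]!; k![n∸k]!∣n!)
open import Data.Nat.Coprimality using (Coprime; coprime-divisor; recompute)
open import Data.Nat.Divisibility using (_∣_; _∤_; divides; ∣1⇒≡1; m∣m*n; ∣-trans; ∣-refl; _∣?_; ∣⇒≤)
open import Data.Nat.DivMod using (m/n*n≡m)
open import Data.Integer using (ℤ; +_; ∣_∣; -[1+_])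
open import Data.List using (_∷ʳ_; reverse; zip; upTo; applyUpTo; map; foldr)
open import Data.List.Properties using (unfold-reverse; applyUpTo-∷ʳ)
open import Data.Rational using (ℚ; mkℚ; ↥_; ↧_; ↧ₙ_; 0ℚ; 1ℚ; _/_; toℚᵘ)
  renaming (_+_ to infixl 6 _⊕_; _*_ to infixl 7 _⊗_; -_ to infix 8 ⊝_)
open import Data.Rational.Unnormalised using (mkℚᵘ; *≡*) renaming (_≃_ to _≃ᵘ_)
open import Data.Product using (_×_; _,_; ∃; proj₁; proj₂)
open import Data.Sum using (inj₁; inj₂; [_,_]′)
open import Function using (_∘_; id)
open import Function.Bundles using (_⇔_; mk⇔)
open import Relation.Nullary using (¬_; yes; no; contradiction)
open import Relation.Nullary.Decidable using (dec⇒maybe)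
open import Relation.Binary.PropositionalEquality
open import Tactic.RingSolver using (solve-∀)
open import Tactic.RingSolver.Core.AlmostCommutativeRing using (fromCommutativeRing)
open import Algebra.Structures {A = ℚ} _≡_ using (IsCommutativeMonoid)
import Data.Nat as ℕ
import Data.Nat.Properties as ℕP
import Data.Integer as ℤ
import Data.Integer.Divisibility as ℤD
import Data.Integer.Properties as ℤP
import Data.Rational.Properties as ℚP
import Data.Rational.Unnormalised as ℚᵘ
import Data.Rational.Unnormalised.Properties as ℚᵘP
import Function.Properties.Equivalence as ⇔
open ≡-Reasoning

-- Integers in ℚ, reciprocals and powers.

ringℚ = fromCommutativeRing ℚP.+-*-commutativeRing (λ x → dec⇒maybe (0ℚ ℚP.≟ x))

-- Opaque, so that the gcd inside _/_ does not unfold on symbolic arguments.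
opaque
  ι : ℤ → ℚ
  ι i = i / 1

  toℚᵘ-ι : ∀ i → toℚᵘ (ι i) ≃ᵘ mkℚᵘ i 0
  toℚᵘ-ι i = ℚP.toℚᵘ-fromℚᵘ (mkℚᵘ i 0)

  ι-≡ : ∀ i → ι i ≡ i / 1
  ι-≡ i = refl

  ι-injective : ∀ {i j} → ι i ≡ ι j → i ≡ j
  ι-injective {i} {j} e with ℚᵘP.≃-trans (ℚᵘP.≃-sym (toℚᵘ-ι i)) (ℚᵘP.≃-trans (ℚP.toℚᵘ-cong e) (toℚᵘ-ι j))
  ... | *≡* q = trans (sym (ℤP.*-identityʳ i)) (trans q (ℤP.*-identityʳ j))

  ι-+ : ∀ i j → ι (i ℤ.+ j) ≡ ι i ⊕ ι j
  ι-+ i j = ℚP.toℚᵘ-injective (ℚᵘP.≃-trans (toℚᵘ-ι (i ℤ.+ j)) (ℚᵘP.≃-trans e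
    (ℚᵘP.≃-sym (ℚᵘP.≃-trans (ℚP.toℚᵘ-homo-+ (ι i) (ι j)) (ℚᵘP.+-cong (toℚᵘ-ι i) (toℚᵘ-ι j))))))
    where
    e : mkℚᵘ (i ℤ.+ j) 0 ≃ᵘ mkℚᵘ i 0 ℚᵘ.+ mkℚᵘ j 0
    e = *≡* (cong₂ ℤ._*_ (sym (cong₂ ℤ._+_ (ℤP.*-identityʳ i) (ℤP.*-identityʳ j))) refl)

  ι-* : ∀ i j → ι (i ℤ.* j) ≡ ι i ⊗ ι j
  ι-* i j = ℚP.toℚᵘ-injective (ℚᵘP.≃-trans (toℚᵘ-ι (i ℤ.* j))
    (ℚᵘP.≃-sym (ℚᵘP.≃-trans (ℚP.toℚᵘ-homo-* (ι i) (ι j)) (ℚᵘP.*-cong (toℚᵘ-ι i) (toℚᵘ-ι j)))))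

  ι-neg : ∀ i → ι (ℤ.- i) ≡ ⊝ ι i
  ι-neg i = ℚP.toℚᵘ-injective (ℚᵘP.≃-trans (toℚᵘ-ι (ℤ.- i))
    (ℚᵘP.≃-sym (ℚᵘP.≃-trans (ℚP.toℚᵘ-homo‿- (ι i)) (ℚᵘP.-‿cong (toℚᵘ-ι i)))))

  -- Ties the lowest-terms form of a rational to integers; conditions on numerators enter the
  -- arithmetic of ℚ through this equation.
  ι-↥ : ∀ x → ι (↧ x) ⊗ x ≡ ι (↥ x)
  ι-↥ x@record{} = ℚP.toℚᵘ-injective (ℚᵘP.≃-trans (ℚP.toℚᵘ-homo-* (ι (↧ x)) x)
    (ℚᵘP.≃-trans (ℚᵘP.*-congʳ (toℚᵘ-ι (↧ x))) (ℚᵘP.≃-trans (*≡* e) (ℚᵘP.≃-sym (toℚᵘ-ι (↥ x))))))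
    where
    e : ↧ x ℤ.* ↥ x ℤ.* + 1 ≡ ↥ x ℤ.* + (1 * ↧ₙ x)
    e = trans (ℤP.*-identityʳ _) (trans (ℤP.*-comm (↧ x) (↥ x)) (cong (λ k → ↥ x ℤ.* + k) (sym (ℕP.*-identityˡ _))))

ν : ℕ → ℚ
ν n = ι (+ n)

ν-+ : ∀ m n → ν (m ℕ.+ n) ≡ ν m ⊕ ν n
ν-+ m n = trans (cong ι (ℤP.pos-+ m n)) (ι-+ (+ m) (+ n))

ν-* : ∀ m n → ν (m * n) ≡ ν m ⊗ ν n
ν-* m n = trans (cong ι (ℤP.pos-* m n)) (ι-* (+ m) (+ n))

ν-0 : ν 0 ≡ 0ℚ
ν-0 = ι-≡ (+ 0)

ν-1 : ν 1 ≡ 1ℚ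
ν-1 = ι-≡ (+ 1)

ν-suc : ∀ n → ν (suc n) ≡ 1ℚ ⊕ ν n
ν-suc n = trans (ν-+ 1 n) (cong (_⊕ ν n) ν-1)

ν-^ : ∀ m e → ν (m ^ e) ≡ powℚ (ν m) e
ν-^ m zero    = ν-1
ν-^ m (suc e) = trans (ν-* m (m ^ e)) (cong (ν m ⊗_) (ν-^ m e))

-- Shifted index: H r n is the sum of the r-th powers of u 0, …, u (n - 1).
u : ℕ → ℚ
u k = + 1 / suc k

opaque
  unfolding ι

  ν-u : ∀ k → ν (suc k) ⊗ u k ≡ 1ℚ
  ν-u k = ℚP.toℚᵘ-injective (ℚᵘP.≃-trans (ℚP.toℚᵘ-homo-* (ν (suc k)) (u k))
    (ℚᵘP.≃-trans (ℚᵘP.*-cong (toℚᵘ-ι (+ suc k)) (ℚP.toℚᵘ-fromℚᵘ (mkℚᵘ (+ 1) k))) (*≡* e)))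
    where
    e : + suc k ℤ.* + 1 ℤ.* + 1 ≡ + 1 ℤ.* + (1 * suc k)
    e = trans (ℤP.*-identityʳ _) (trans (ℤP.*-identityʳ _) (sym (trans (ℤP.*-identityˡ _) (cong +_ (ℕP.*-identityˡ (suc k))))))

ν-cancel : ∀ k {x y} → ν (suc k) ⊗ x ≡ ν (suc k) ⊗ y → x ≡ y
ν-cancel k {x} {y} e = begin
  x                         ≡⟨ h x ⟩
  u k ⊗ (ν (suc k) ⊗ x)     ≡⟨ cong (u k ⊗_) e ⟩
  u k ⊗ (ν (suc k) ⊗ y)     ≡⟨ h y ⟨
  y                         ∎
  where
  h : ∀ z → z ≡ u k ⊗ (ν (suc k) ⊗ z)
  h z = sym (trans (sym (ℚP.*-assoc (u k) (ν (suc k)) z))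
    (trans (cong (_⊗ z) (trans (ℚP.*-comm (u k) (ν (suc k))) (ν-u k))) (ℚP.*-identityˡ z)))

pow-+ : ∀ x m n → powℚ x (m ℕ.+ n) ≡ powℚ x m ⊗ powℚ x n
pow-+ x zero    n = sym (ℚP.*-identityˡ _)
pow-+ x (suc m) n = trans (cong (x ⊗_) (pow-+ x m n)) (sym (ℚP.*-assoc x _ _))

pow-⊗ : ∀ x y n → powℚ (x ⊗ y) n ≡ powℚ x n ⊗ powℚ y n
pow-⊗ x y zero    = refl
pow-⊗ x y (suc n) = trans (cong ((x ⊗ y) ⊗_) (pow-⊗ x y n)) (swap x y (powℚ x n) (powℚ y n))
  where
  swap : ∀ a b c d → a ⊗ b ⊗ (c ⊗ d) ≡ a ⊗ c ⊗ (b ⊗ d)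
  swap = solve-∀ ringℚ

pow-* : ∀ x m n → powℚ x (m * n) ≡ powℚ (powℚ x n) m
pow-* x zero    n = refl
pow-* x (suc m) n = trans (pow-+ x n (m * n)) (cong (powℚ x n ⊗_) (pow-* x m n))

pow-1 : ∀ n → powℚ 1ℚ n ≡ 1ℚ
pow-1 zero    = refl
pow-1 (suc n) = trans (ℚP.*-identityˡ (powℚ 1ℚ n)) (pow-1 n)

pow-0 : ∀ n → powℚ 0ℚ (suc n) ≡ 0ℚ
pow-0 n = ℚP.*-zeroˡ (powℚ 0ℚ n)

nC0≡1 : ∀ n → n C 0 ≡ 1
nC0≡1 n = trans (nCk≡nC[n∸k] {0} {n} z≤n) (nCn≡1 n)

-- Finite sums and products.

module BigOp {_∙_ : ℚ → ℚ → ℚ} {ε : ℚ} (M : IsCommutativeMonoid _∙_ ε) where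
  open IsCommutativeMonoid M using (assoc; comm; identityˡ)

  big : ℕ → (ℕ → ℚ) → ℚ
  big zero    f = ε
  big (suc n) f = big n f ∙ f n

  big-cong : ∀ n {f g} → (∀ k → k < n → f k ≡ g k) → big n f ≡ big n g
  big-cong zero    h = refl
  big-cong (suc n) h = cong₂ _∙_ (big-cong n (λ k k<n → h k (ℕP.m<n⇒m<1+n k<n))) (h n (ℕP.n<1+n n))

  big-∙ : ∀ n f g → big n (λ k → f k ∙ g k) ≡ big n f ∙ big n g
  big-∙ zero    f g = sym (identityˡ ε)
  big-∙ (suc n) f g = begin
    big n (λ k → f k ∙ g k) ∙ (f n ∙ g n)       ≡⟨ cong (_∙ (f n ∙ g n)) (big-∙ n f g) ⟩
    (big n f ∙ big n g) ∙ (f n ∙ g n)           ≡⟨ assoc (big n f) (big n g) _ ⟩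
    big n f ∙ (big n g ∙ (f n ∙ g n))           ≡⟨ cong (big n f ∙_) swap ⟩
    big n f ∙ (f n ∙ (big n g ∙ g n))           ≡⟨ assoc (big n f) (f n) _ ⟨
    (big n f ∙ f n) ∙ (big n g ∙ g n)           ∎
    where
    swap : big n g ∙ (f n ∙ g n) ≡ f n ∙ (big n g ∙ g n)
    swap = trans (sym (assoc (big n g) (f n) (g n)))
      (trans (cong (_∙ g n) (comm (big n g) (f n))) (assoc (f n) (big n g) (g n)))

  big-suc : ∀ n f → big (suc n) f ≡ f 0 ∙ big n (f ∘ suc)
  big-suc zero    f = comm ε (f 0)
  big-suc (suc n) f = trans (cong (_∙ f (suc n)) (big-suc n f)) (assoc (f 0) (big n (f ∘ suc)) (f (suc n)))

  -- For pairing K with p - K: when n = p - 1, the index k stands for K = k + 1 and `n ∸ suc k` for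
  -- p - K.
  big-reverse : ∀ n f → big n f ≡ big n (λ k → f (n ∸ suc k))
  big-reverse zero    f = refl
  big-reverse (suc n) f = begin
    big n f ∙ f n                               ≡⟨ cong (_∙ f n) (big-reverse n f) ⟩
    big n (λ k → f (n ∸ suc k)) ∙ f n           ≡⟨ comm _ (f n) ⟩
    f n ∙ big n (λ k → f (n ∸ suc k))           ≡⟨ big-suc n (λ k → f (n ∸ k)) ⟨
    big (suc n) (λ k → f (n ∸ k))               ∎

open BigOp ℚP.+-0-isCommutativeMonoid
  using () renaming (big to ∑; big-cong to ∑-cong; big-∙ to ∑-⊕; big-suc to ∑-suc; big-reverse to ∑-reverse)
open BigOp ℚP.*-1-isCommutativeMonoid
  using () renaming (big to ∏; big-cong to ∏-cong; big-∙ to ∏-⊗; big-reverse to ∏-reverse)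

∑-⊗ : ∀ n c f → ∑ n (λ k → c ⊗ f k) ≡ c ⊗ ∑ n f
∑-⊗ zero    c f = sym (ℚP.*-zeroʳ c)
∑-⊗ (suc n) c f = trans (cong (_⊕ c ⊗ f n) (∑-⊗ n c f)) (sym (ℚP.*-distribˡ-+ c (∑ n f) (f n)))

∑-⊝ : ∀ n f → ∑ n (λ k → ⊝ f k) ≡ ⊝ ∑ n f
∑-⊝ zero    f = refl
∑-⊝ (suc n) f = trans (cong (_⊕ ⊝ f n) (∑-⊝ n f)) (sym (ℚP.neg-distrib-+ (∑ n f) (f n)))

-- Exponential generating functions.

-- Product of exponential generating functions (see ⋆-C).  The Leibniz rule, with f ∘ suc as
-- derivative of f, is taken as definition since it makes associativity a direct induction.
infixl 7 _⋆_

_⋆_ : (ℕ → ℚ) → (ℕ → ℚ) → ℕ → ℚ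
(f ⋆ g) zero    = f 0 ⊗ g 0
(f ⋆ g) (suc n) = (f ∘ suc ⋆ g) n ⊕ (f ⋆ g ∘ suc) n

⋆-cong : ∀ {f f′ g g′} → f ≗ f′ → g ≗ g′ → f ⋆ g ≗ f′ ⋆ g′
⋆-cong p q zero    = cong₂ _⊗_ (p 0) (q 0)
⋆-cong p q (suc n) = cong₂ _⊕_ (⋆-cong (p ∘ suc) q n) (⋆-cong p (q ∘ suc) n)

⋆-comm : ∀ f g → f ⋆ g ≗ g ⋆ f
⋆-comm f g zero    = ℚP.*-comm (f 0) (g 0)
⋆-comm f g (suc n) = trans (ℚP.+-comm ((f ∘ suc ⋆ g) n) _) (cong₂ _⊕_ (⋆-comm f (g ∘ suc) n) (⋆-comm (f ∘ suc) g n))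

⊕-interchange : ∀ a b c d → (a ⊕ b) ⊕ (c ⊕ d) ≡ (a ⊕ c) ⊕ (b ⊕ d)
⊕-interchange = solve-∀ ringℚ

⋆-distribʳ : ∀ f g h → (λ n → f n ⊕ g n) ⋆ h ≗ λ n → (f ⋆ h) n ⊕ (g ⋆ h) n
⋆-distribʳ f g h zero    = ℚP.*-distribʳ-+ (h 0) (f 0) (g 0)
⋆-distribʳ f g h (suc n) = trans (cong₂ _⊕_ (⋆-distribʳ (f ∘ suc) (g ∘ suc) h n) (⋆-distribʳ f g (h ∘ suc) n))
  (⊕-interchange ((f ∘ suc ⋆ h) n) ((g ∘ suc ⋆ h) n) ((f ⋆ h ∘ suc) n) ((g ⋆ h ∘ suc) n))

⋆-distribˡ : ∀ f g h → f ⋆ (λ n → g n ⊕ h n) ≗ λ n → (f ⋆ g) n ⊕ (f ⋆ h) n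
⋆-distribˡ f g h n = trans (⋆-comm f _ n) (trans (⋆-distribʳ g h f n) (cong₂ _⊕_ (⋆-comm g f n) (⋆-comm h f n)))

⋆-scaleˡ : ∀ c f g → (λ n → c ⊗ f n) ⋆ g ≗ λ n → c ⊗ (f ⋆ g) n
⋆-scaleˡ c f g zero    = ℚP.*-assoc c (f 0) (g 0)
⋆-scaleˡ c f g (suc n) = trans (cong₂ _⊕_ (⋆-scaleˡ c (f ∘ suc) g n) (⋆-scaleˡ c f (g ∘ suc) n))
  (sym (ℚP.*-distribˡ-+ c ((f ∘ suc ⋆ g) n) ((f ⋆ g ∘ suc) n)))

⋆-zeroˡ : ∀ g → (λ _ → 0ℚ) ⋆ g ≗ λ _ → 0ℚ
⋆-zeroˡ g zero    = ℚP.*-zeroˡ (g 0)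
⋆-zeroˡ g (suc n) = cong₂ _⊕_ (⋆-zeroˡ g n) (⋆-zeroˡ (g ∘ suc) n)

⋆-assoc : ∀ f g h → (f ⋆ g) ⋆ h ≗ f ⋆ (g ⋆ h)
⋆-assoc f g h zero    = ℚP.*-assoc (f 0) (g 0) (h 0)
⋆-assoc f g h (suc n) = begin
  ((f ⋆ g) ∘ suc ⋆ h) n ⊕ (f ⋆ g ⋆ h ∘ suc) n
    ≡⟨ cong (_⊕ (f ⋆ g ⋆ h ∘ suc) n) (⋆-distribʳ (f ∘ suc ⋆ g) (f ⋆ g ∘ suc) h n) ⟩
  (f ∘ suc ⋆ g ⋆ h) n ⊕ (f ⋆ g ∘ suc ⋆ h) n ⊕ (f ⋆ g ⋆ h ∘ suc) n
    ≡⟨ ℚP.+-assoc ((f ∘ suc ⋆ g ⋆ h) n) _ _ ⟩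
  (f ∘ suc ⋆ g ⋆ h) n ⊕ ((f ⋆ g ∘ suc ⋆ h) n ⊕ (f ⋆ g ⋆ h ∘ suc) n)
    ≡⟨ cong₂ _⊕_ (⋆-assoc (f ∘ suc) g h n) (cong₂ _⊕_ (⋆-assoc f (g ∘ suc) h n) (⋆-assoc f g (h ∘ suc) n)) ⟩
  (f ∘ suc ⋆ (g ⋆ h)) n ⊕ ((f ⋆ (g ∘ suc ⋆ h)) n ⊕ (f ⋆ (g ⋆ h ∘ suc)) n)
    ≡⟨ cong ((f ∘ suc ⋆ (g ⋆ h)) n ⊕_) (⋆-distribˡ f (g ∘ suc ⋆ h) (g ⋆ h ∘ suc) n) ⟨
  (f ∘ suc ⋆ (g ⋆ h)) n ⊕ (f ⋆ (g ⋆ h) ∘ suc) n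
    ∎

-- Induction with Pascal's rule: the two halves of the Leibniz rule contribute C(n,k) and C(n,k+1).
⋆-C : ∀ f g n → (f ⋆ g) n ≡ ∑ (suc n) (λ k → ν (n C k) ⊗ (f k ⊗ g (n ∸ k)))
⋆-C f g zero    = sym (trans (ℚP.+-identityˡ (ν (0 C 0) ⊗ (f 0 ⊗ g 0))) (trans (cong (_⊗ (f 0 ⊗ g 0)) ν-1) (ℚP.*-identityˡ (f 0 ⊗ g 0))))
⋆-C f g (suc n) = begin
  (f ∘ suc ⋆ g) n ⊕ (f ⋆ g ∘ suc) n
    ≡⟨ cong₂ _⊕_ (⋆-C (f ∘ suc) g n) (⋆-C f (g ∘ suc) n) ⟩
  A ⊕ ∑ (suc n) (λ k → ν (n C k) ⊗ (f k ⊗ g (suc (n ∸ k))))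
    ≡⟨ cong (A ⊕_) (∑-cong (suc n) (λ k k≤n → cong (λ j → ν (n C k) ⊗ (f k ⊗ g j)) (sym (ℕP.+-∸-assoc 1 (ℕP.≤-pred k≤n))))) ⟩
  A ⊕ ∑ (suc n) h
    ≡⟨ cong (A ⊕_) (∑-suc n h) ⟩
  A ⊕ (h 0 ⊕ ∑ n (h ∘ suc))
    -- The added top term has coefficient C(n,n+1) = 0; it gives both sums the same range.
    ≡⟨ cong (λ s → A ⊕ (h 0 ⊕ s)) last≡0 ⟨
  A ⊕ (h 0 ⊕ ∑ (suc n) (h ∘ suc))
    ≡⟨ rearrange A (h 0) _ ⟩
  h 0 ⊕ (A ⊕ ∑ (suc n) (h ∘ suc))
    ≡⟨ cong₂ _⊕_ (cong (λ c → ν c ⊗ (f 0 ⊗ g (suc n))) nC0) (sym (∑-⊕ (suc n) _ (h ∘ suc))) ⟩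
  r 0 ⊕ ∑ (suc n) (λ k → ν (n C k) ⊗ (f (suc k) ⊗ g (n ∸ k)) ⊕ h (suc k))
    ≡⟨ cong (r 0 ⊕_) (∑-cong (suc n) (λ k _ → pascal k)) ⟩
  r 0 ⊕ ∑ (suc n) (r ∘ suc)
    ≡⟨ ∑-suc (suc n) r ⟨
  ∑ (suc (suc n)) r
    ∎
  where
  h r : ℕ → ℚ
  h k = ν (n C k) ⊗ (f k ⊗ g (suc n ∸ k))
  r k = ν (suc n C k) ⊗ (f k ⊗ g (suc n ∸ k))
  A : ℚ
  A = ∑ (suc n) (λ k → ν (n C k) ⊗ (f (suc k) ⊗ g (n ∸ k)))
  nC0 : n C 0 ≡ suc n C 0
  nC0 = trans (nC0≡1 n) (sym (nC0≡1 (suc n)))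
  rearrange : ∀ a b c → a ⊕ (b ⊕ c) ≡ b ⊕ (a ⊕ c)
  rearrange = solve-∀ ringℚ
  last≡0 : ∑ (suc n) (h ∘ suc) ≡ ∑ n (h ∘ suc)
  last≡0 = begin
    ∑ n (h ∘ suc) ⊕ ν (n C suc n) ⊗ z    ≡⟨ cong (λ c → ∑ n (h ∘ suc) ⊕ c ⊗ z) (trans (cong ν (k>n⇒nCk≡0 (ℕP.n<1+n n))) ν-0) ⟩
    ∑ n (h ∘ suc) ⊕ 0ℚ ⊗ z               ≡⟨ cong (∑ n (h ∘ suc) ⊕_) (ℚP.*-zeroˡ z) ⟩
    ∑ n (h ∘ suc) ⊕ 0ℚ                   ≡⟨ ℚP.+-identityʳ _ ⟩
    ∑ n (h ∘ suc)                        ∎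
    where
    z = f (suc n) ⊗ g (n ∸ n)
  pascal : ∀ k → ν (n C k) ⊗ (f (suc k) ⊗ g (n ∸ k)) ⊕ h (suc k) ≡ r (suc k)
  pascal k = begin
    ν (n C k) ⊗ z ⊕ ν (n C suc k) ⊗ z       ≡⟨ ℚP.*-distribʳ-+ z (ν (n C k)) (ν (n C suc k)) ⟨
    (ν (n C k) ⊕ ν (n C suc k)) ⊗ z         ≡⟨ cong (_⊗ z) (ν-+ (n C k) (n C suc k)) ⟨
    ν (n C k ℕ.+ n C suc k) ⊗ z             ≡⟨ cong (λ c → ν c ⊗ z) (nCk+nC[k+1]≡[n+1]C[k+1] n k) ⟩
    ν (suc n C suc k) ⊗ z                   ∎
    where
    z = f (suc k) ⊗ g (n ∸ k)

-- `powℚ x` is the coefficient sequence of e^(xt), whose derivative is x e^(xt). Together with `⋆-C`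
-- this is the binomial theorem.
pow-⋆ : ∀ x y → powℚ x ⋆ powℚ y ≗ powℚ (x ⊕ y)
pow-⋆ x y zero    = refl
pow-⋆ x y (suc n) = begin
  ((λ k → x ⊗ powℚ x k) ⋆ powℚ y) n ⊕ (powℚ x ⋆ (λ k → y ⊗ powℚ y k)) n
    ≡⟨ cong₂ _⊕_ (⋆-scaleˡ x (powℚ x) (powℚ y) n)
         (trans (⋆-comm (powℚ x) _ n) (trans (⋆-scaleˡ y (powℚ y) (powℚ x) n) (cong (y ⊗_) (⋆-comm (powℚ y) (powℚ x) n)))) ⟩
  x ⊗ (powℚ x ⋆ powℚ y) n ⊕ y ⊗ (powℚ x ⋆ powℚ y) n
    ≡⟨ ℚP.*-distribʳ-+ ((powℚ x ⋆ powℚ y) n) x y ⟨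
  (x ⊕ y) ⊗ (powℚ x ⋆ powℚ y) n
    ≡⟨ cong ((x ⊕ y) ⊗_) (pow-⋆ x y n) ⟩
  (x ⊕ y) ⊗ powℚ (x ⊕ y) n
    ∎

-- The generating functions 1 and t.
δ τ : ℕ → ℚ
δ zero    = 1ℚ
δ (suc n) = 0ℚ
τ zero    = 0ℚ
τ (suc n) = δ n

⋆-identityˡ : ∀ f → δ ⋆ f ≗ f
⋆-identityˡ f zero    = ℚP.*-identityˡ (f 0)
⋆-identityˡ f (suc n) = trans (cong₂ _⊕_ (⋆-zeroˡ f n) (⋆-identityˡ (f ∘ suc) n)) (ℚP.+-identityˡ (f (suc n)))

τ⋆-zero : ∀ f → (τ ⋆ f) 0 ≡ 0ℚ
τ⋆-zero f = ℚP.*-zeroˡ (f 0)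

-- The derivative of t f is f + t f′, which gives the induction. The factor m + 1 is invertible in
-- ℚ, so t can be cancelled.
τ⋆-suc : ∀ f m → (τ ⋆ f) (suc m) ≡ ν (suc m) ⊗ f m
τ⋆-suc f zero = begin
  1ℚ ⊗ f 0 ⊕ 0ℚ ⊗ f 1     ≡⟨ cong₂ _⊕_ (cong (_⊗ f 0) (sym ν-1)) (ℚP.*-zeroˡ (f 1)) ⟩
  ν 1 ⊗ f 0 ⊕ 0ℚ          ≡⟨ ℚP.+-identityʳ _ ⟩
  ν 1 ⊗ f 0               ∎
τ⋆-suc f (suc m) = begin
  (δ ⋆ f) (suc m) ⊕ (τ ⋆ f ∘ suc) (suc m)        ≡⟨ cong₂ _⊕_ (⋆-identityˡ f (suc m)) (τ⋆-suc (f ∘ suc) m) ⟩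
  f (suc m) ⊕ ν (suc m) ⊗ f (suc m)              ≡⟨ ring (f (suc m)) (ν (suc m)) ⟩
  (1ℚ ⊕ ν (suc m)) ⊗ f (suc m)                   ≡⟨ cong (_⊗ f (suc m)) (ν-suc (suc m)) ⟨
  ν (suc (suc m)) ⊗ f (suc m)                    ∎
  where
  ring : ∀ a b → a ⊕ b ⊗ a ≡ (1ℚ ⊕ b) ⊗ a
  ring = solve-∀ ringℚ

-- Bernoulli numbers: recurrence and generating function.

reverse-bernRev : ∀ m → reverse (bernRev m) ≡ applyUpTo bernoulli (suc m)
reverse-bernRev zero    = refl
reverse-bernRev (suc m) = begin
  reverse (bernRev (suc m))                          ≡⟨ unfold-reverse (bernoulli (suc m)) (bernRev m) ⟩
  reverse (bernRev m) ∷ʳ bernoulli (suc m)           ≡⟨ cong (_∷ʳ bernoulli (suc m)) (reverse-bernRev m) ⟩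
  applyUpTo bernoulli (suc m) ∷ʳ bernoulli (suc m)   ≡⟨ applyUpTo-∷ʳ bernoulli (suc m) ⟩
  applyUpTo bernoulli (suc (suc m))                  ∎

foldr-zip-upTo : ∀ (F : ℕ × ℚ → ℚ) i f n →
  foldr _⊕_ 0ℚ (map F (zip (applyUpTo i n) (applyUpTo f n))) ≡ ∑ n (λ k → F (i k , f k))
foldr-zip-upTo F i f zero    = refl
foldr-zip-upTo F i f (suc n) = trans (cong (F (i 0 , f 0) ⊕_) (foldr-zip-upTo F (i ∘ suc) (f ∘ suc) n))
                                     (sym (∑-suc n (λ k → F (i k , f k))))

-- F stands for the pattern-matching lambda of bernRev, which has no name outside Defs.
foldr-bernRev : ∀ {F : ℕ × ℚ → ℚ} (g : ℕ → ℚ) → (∀ k b → F (k , b) ≡ g k ⊗ b) → ∀ m →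
  foldr _⊕_ 0ℚ (map F (zip (upTo (suc m)) (reverse (bernRev m)))) ≡ ∑ (suc m) (λ k → g k ⊗ bernoulli k)
foldr-bernRev {F} g F≗ m = begin
  foldr _⊕_ 0ℚ (map F (zip (upTo (suc m)) (reverse (bernRev m))))
    ≡⟨ cong (λ l → foldr _⊕_ 0ℚ (map F (zip (upTo (suc m)) l))) (reverse-bernRev m) ⟩
  foldr _⊕_ 0ℚ (map F (zip (upTo (suc m)) (applyUpTo bernoulli (suc m))))
    ≡⟨ foldr-zip-upTo F id bernoulli (suc m) ⟩
  ∑ (suc m) (λ k → F (k , bernoulli k))
    ≡⟨ ∑-cong (suc m) (λ k _ → F≗ k (bernoulli k)) ⟩
  ∑ (suc m) (λ k → g k ⊗ bernoulli k)
    ∎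

bernoulli-suc : ∀ m → bernoulli (suc m) ≡ ⊝ (u (suc m) ⊗ ∑ (suc m) (λ k → ν (suc (suc m) C k) ⊗ bernoulli k))
bernoulli-suc m = cong (λ s → ⊝ (u (suc m) ⊗ s))
  (foldr-bernRev (λ k → ν (suc (suc m) C k)) (λ k b → cong (_⊗ b) (sym (ι-≡ (+ (suc (suc m) C k))))) m)

[1+n]Cn≡1+n : ∀ n → suc n C n ≡ suc n
[1+n]Cn≡1+n n = trans (nCk≡nC[n∸k] (ℕP.n≤1+n n)) (trans (cong (suc n C_) (ℕP.m+n∸n≡m 1 n)) (nC1≡n (suc n)))

-- For positive m the definition solves this equation for its last term, whose coefficient is
-- C(m+1,m) = m + 1.
bernoulli-recurrence : ∀ m → ∑ (suc m) (λ k → ν (suc m C k) ⊗ bernoulli k) ≡ δ m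
bernoulli-recurrence zero    = cong (λ c → 0ℚ ⊕ c ⊗ 1ℚ) ν-1
bernoulli-recurrence (suc m) = begin
  X ⊕ ν (suc (suc m) C suc m) ⊗ bernoulli (suc m)
    ≡⟨ cong₂ (λ c b → X ⊕ ν c ⊗ b) ([1+n]Cn≡1+n (suc m)) (bernoulli-suc m) ⟩
  X ⊕ ν (suc (suc m)) ⊗ ⊝ (u (suc m) ⊗ X)
    ≡⟨ ring X (ν (suc (suc m))) (u (suc m)) ⟩
  X ⊕ ⊝ (ν (suc (suc m)) ⊗ u (suc m) ⊗ X)
    ≡⟨ cong (λ c → X ⊕ ⊝ (c ⊗ X)) (ν-u (suc m)) ⟩
  X ⊕ ⊝ (1ℚ ⊗ X)
    ≡⟨ cancel X ⟩
  0ℚ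
    ∎
  where
  X = ∑ (suc m) (λ k → ν (suc (suc m) C k) ⊗ bernoulli k)
  ring : ∀ x n u → x ⊕ n ⊗ ⊝ (u ⊗ x) ≡ x ⊕ ⊝ (n ⊗ u ⊗ x)
  ring = solve-∀ ringℚ
  cancel : ∀ x → x ⊕ ⊝ (1ℚ ⊗ x) ≡ 0ℚ
  cancel = solve-∀ ringℚ

-- B(t) e^t = B(t) + t
bernoulli-⋆ : bernoulli ⋆ powℚ 1ℚ ≗ λ n → bernoulli n ⊕ τ n
bernoulli-⋆ zero    = refl
bernoulli-⋆ (suc m) = begin
  (bernoulli ⋆ powℚ 1ℚ) (suc m)
    ≡⟨ ⋆-C bernoulli (powℚ 1ℚ) (suc m) ⟩
  ∑ (suc (suc m)) (λ k → ν (suc m C k) ⊗ (bernoulli k ⊗ powℚ 1ℚ (suc m ∸ k)))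
    ≡⟨ ∑-cong (suc (suc m)) (λ k _ → cong (ν (suc m C k) ⊗_) (trans (cong (bernoulli k ⊗_) (pow-1 (suc m ∸ k))) (ℚP.*-identityʳ (bernoulli k)))) ⟩
  ∑ (suc m) (λ k → ν (suc m C k) ⊗ bernoulli k) ⊕ ν (suc m C suc m) ⊗ bernoulli (suc m)
    ≡⟨ cong₂ (λ s c → s ⊕ c ⊗ bernoulli (suc m)) (bernoulli-recurrence m) (trans (cong ν (nCn≡1 (suc m))) ν-1) ⟩
  δ m ⊕ 1ℚ ⊗ bernoulli (suc m)
    ≡⟨ cong (δ m ⊕_) (ℚP.*-identityˡ (bernoulli (suc m))) ⟩
  δ m ⊕ bernoulli (suc m)
    ≡⟨ ℚP.+-comm (δ m) (bernoulli (suc m)) ⟩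
  bernoulli (suc m) ⊕ δ m
    ∎

-- Power sums and Faulhaber's formula.

S : ℕ → ℕ → ℚ
S N m = ∑ N (λ k → powℚ (ν k) m)

-- S(t) (e^t - 1) = e^(Nt) - 1
S-⋆ : ∀ N m → (S N ⋆ powℚ 1ℚ) m ⊕ powℚ (ν 0) m ≡ S N m ⊕ powℚ (ν N) m
S-⋆ zero    m = cong (_⊕ powℚ (ν 0) m) (⋆-zeroˡ (powℚ 1ℚ) m)
S-⋆ (suc N) m = begin
  (S (suc N) ⋆ powℚ 1ℚ) m ⊕ powℚ (ν 0) m
    ≡⟨ cong (_⊕ powℚ (ν 0) m) (⋆-distribʳ (S N) (powℚ (ν N)) (powℚ 1ℚ) m) ⟩
  (S N ⋆ powℚ 1ℚ) m ⊕ (powℚ (ν N) ⋆ powℚ 1ℚ) m ⊕ powℚ (ν 0) m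
    ≡⟨ ring ((S N ⋆ powℚ 1ℚ) m) _ _ ⟩
  (S N ⋆ powℚ 1ℚ) m ⊕ powℚ (ν 0) m ⊕ (powℚ (ν N) ⋆ powℚ 1ℚ) m
    ≡⟨ cong₂ _⊕_ (S-⋆ N m) (trans (pow-⋆ (ν N) 1ℚ m) (cong (λ x → powℚ x m) (trans (ℚP.+-comm (ν N) 1ℚ) (sym (ν-suc N))))) ⟩
  S (suc N) m ⊕ powℚ (ν (suc N)) m
    ∎
  where
  ring : ∀ a b c → a ⊕ b ⊕ c ≡ a ⊕ c ⊕ b
  ring = solve-∀ ringℚ

module _ (N : ℕ) where

  -- t G(t) = e^(Nt) - 1, so t S(t) = B(t) (e^(Nt) - 1) = t B(t) G(t).
  G : ℕ → ℚ
  G i = powℚ (ν N) (suc i) ⊗ u i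

  -- The series 1 is written `powℚ (ν 0)`, that is e^(0t), as in `S-⋆`, where this makes the case N
  -- = 0 immediate.
  τ⋆G : ∀ n → (τ ⋆ G) n ⊕ powℚ (ν 0) n ≡ powℚ (ν N) n
  τ⋆G zero    = trans (cong (_⊕ 1ℚ) (τ⋆-zero G)) (ℚP.+-identityˡ 1ℚ)
  τ⋆G (suc m) = begin
    (τ ⋆ G) (suc m) ⊕ ν 0 ⊗ powℚ (ν 0) m         ≡⟨ cong₂ (λ s z → s ⊕ z ⊗ powℚ (ν 0) m) (τ⋆-suc G m) ν-0 ⟩
    ν (suc m) ⊗ (x ⊗ u m) ⊕ 0ℚ ⊗ powℚ (ν 0) m    ≡⟨ ring (ν (suc m)) x (u m) (powℚ (ν 0) m) ⟩
    ν (suc m) ⊗ u m ⊗ x                          ≡⟨ cong (_⊗ x) (ν-u m) ⟩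
    1ℚ ⊗ x                                       ≡⟨ ℚP.*-identityˡ x ⟩
    x                                            ∎
    where
    x = powℚ (ν N) (suc m)
    ring : ∀ n x u z → n ⊗ (x ⊗ u) ⊕ 0ℚ ⊗ z ≡ n ⊗ u ⊗ x
    ring = solve-∀ ringℚ

  τ⋆S : τ ⋆ S N ≗ τ ⋆ (bernoulli ⋆ G)
  τ⋆S n = begin
    -- B S and B are added and subtracted, since `bernoulli-⋆`, `S-⋆` and `τ⋆G` are identities
    -- between sums.
    (τ ⋆ S N) n                  ≡⟨ cancel bS ((τ ⋆ S N) n) b0 ⟩
    bS ⊕ (τ ⋆ S N) n ⊕ b0 ⊕ ⊝ (bS ⊕ b0)
      ≡⟨ cong (λ s → s ⊕ b0 ⊕ ⊝ (bS ⊕ b0)) (⋆-distribʳ bernoulli τ (S N) n) ⟨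
    ((λ k → bernoulli k ⊕ τ k) ⋆ S N) n ⊕ b0 ⊕ ⊝ (bS ⊕ b0)
      ≡⟨ cong (λ s → s ⊕ b0 ⊕ ⊝ (bS ⊕ b0)) (⋆-cong {g = S N} (λ k → sym (bernoulli-⋆ k)) (λ _ → refl) n) ⟩
    (bernoulli ⋆ powℚ 1ℚ ⋆ S N) n ⊕ b0 ⊕ ⊝ (bS ⊕ b0)
      ≡⟨ cong (λ s → s ⊕ b0 ⊕ ⊝ (bS ⊕ b0)) (trans (⋆-assoc bernoulli (powℚ 1ℚ) (S N) n)
           (⋆-cong {f = bernoulli} (λ _ → refl) (⋆-comm (powℚ 1ℚ) (S N)) n)) ⟩
    (bernoulli ⋆ (S N ⋆ powℚ 1ℚ)) n ⊕ b0 ⊕ ⊝ (bS ⊕ b0)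
      ≡⟨ cong (_⊕ ⊝ (bS ⊕ b0)) (trans (sym (⋆-distribˡ bernoulli (S N ⋆ powℚ 1ℚ) (powℚ (ν 0)) n))
           (⋆-cong {f = bernoulli} (λ _ → refl) (S-⋆ N) n)) ⟩
    (bernoulli ⋆ (λ k → S N k ⊕ powℚ (ν N) k)) n ⊕ ⊝ (bS ⊕ b0)
      ≡⟨ cong (_⊕ ⊝ (bS ⊕ b0)) (trans (⋆-distribˡ bernoulli (S N) (powℚ (ν N)) n)
           (cong (bS ⊕_) (⋆-cong {f = bernoulli} (λ _ → refl) (λ k → sym (τ⋆G k)) n))) ⟩
    bS ⊕ (bernoulli ⋆ (λ k → (τ ⋆ G) k ⊕ powℚ (ν 0) k)) n ⊕ ⊝ (bS ⊕ b0)
      ≡⟨ cong (λ s → bS ⊕ s ⊕ ⊝ (bS ⊕ b0)) (⋆-distribˡ bernoulli (τ ⋆ G) (powℚ (ν 0)) n) ⟩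
    bS ⊕ ((bernoulli ⋆ (τ ⋆ G)) n ⊕ b0) ⊕ ⊝ (bS ⊕ b0)
      ≡⟨ cancel′ bS _ b0 ⟩
    (bernoulli ⋆ (τ ⋆ G)) n
      ≡⟨ ⋆-assoc bernoulli τ G n ⟨
    (bernoulli ⋆ τ ⋆ G) n
      ≡⟨ ⋆-cong {g = G} (⋆-comm bernoulli τ) (λ _ → refl) n ⟩
    (τ ⋆ bernoulli ⋆ G) n
      ≡⟨ ⋆-assoc τ bernoulli G n ⟩
    (τ ⋆ (bernoulli ⋆ G)) n
      ∎
    where
    bS = (bernoulli ⋆ S N) n
    b0 = (bernoulli ⋆ powℚ (ν 0)) n
    cancel : ∀ a x b → x ≡ a ⊕ x ⊕ b ⊕ ⊝ (a ⊕ b)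
    cancel = solve-∀ ringℚ
    cancel′ : ∀ a x b → a ⊕ (x ⊕ b) ⊕ ⊝ (a ⊕ b) ≡ x
    cancel′ = solve-∀ ringℚ

  -- The factor t is cancelled by comparing the coefficients of index m + 1.
  S≗bernoulli⋆G : S N ≗ bernoulli ⋆ G
  S≗bernoulli⋆G m = ν-cancel m (trans (sym (τ⋆-suc (S N) m)) (trans (τ⋆S (suc m)) (τ⋆-suc (bernoulli ⋆ G) m)))

  -- The term k = m of B G is split off. In the others one factor N stays with B_k, because for N =
  -- p it is p B_k rather than B_k that is shown to be p-integral.
  faulhaber : ∀ m → S N m ≡
    ν N ⊗ bernoulli m ⊕ ∑ m (λ k → ν (m C k) ⊗ ((ν N ⊗ bernoulli k) ⊗ (powℚ (ν N) (m ∸ k) ⊗ u (m ∸ k))))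
  faulhaber m = begin
    S N m
      ≡⟨ S≗bernoulli⋆G m ⟩
    (bernoulli ⋆ G) m
      ≡⟨ ⋆-C bernoulli G m ⟩
    ∑ m (λ k → ν (m C k) ⊗ (bernoulli k ⊗ G (m ∸ k))) ⊕ ν (m C m) ⊗ (bernoulli m ⊗ G (m ∸ m))
      ≡⟨ cong₂ _⊕_ (∑-cong m (λ k _ → ring (ν (m C k)) (bernoulli k) (ν N) (powℚ (ν N) (m ∸ k)) (u (m ∸ k))))
                   (cong₂ (λ c i → c ⊗ (bernoulli m ⊗ G i)) (trans (cong ν (nCn≡1 m)) ν-1) (ℕP.n∸n≡0 m)) ⟩
    R ⊕ 1ℚ ⊗ (bernoulli m ⊗ (ν N ⊗ 1ℚ ⊗ 1ℚ))
      ≡⟨ ring′ R (bernoulli m) (ν N) ⟩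
    ν N ⊗ bernoulli m ⊕ R
      ∎
    where
    R = ∑ m (λ k → ν (m C k) ⊗ ((ν N ⊗ bernoulli k) ⊗ (powℚ (ν N) (m ∸ k) ⊗ u (m ∸ k))))
    ring : ∀ c b n x u → c ⊗ (b ⊗ (n ⊗ x ⊗ u)) ≡ c ⊗ ((n ⊗ b) ⊗ (x ⊗ u))
    ring = solve-∀ ringℚ
    ring′ : ∀ r b n → r ⊕ 1ℚ ⊗ (b ⊗ (n ⊗ 1ℚ ⊗ 1ℚ)) ≡ n ⊗ b ⊕ r
    ring′ = solve-∀ ringℚ

-- Binomial coefficients and identities for reciprocals.

C-! : ∀ {n k} → k ≤ n → (n C k) * (k ! * (n ∸ k) !) ≡ n !
C-! {n} {k} k≤n = trans (cong (_* (k ! * (n ∸ k) !)) (nCk≡n!/k![n-k]! k≤n))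
  (m/n*n≡m {{ℕP.m*n≢0 (k !) ((n ∸ k) !) {{k ℕP.!≢0}} {{(n ∸ k) ℕP.!≢0}}}} (k![n∸k]!∣n! k≤n))

H-∑ : ∀ r n → H r n ≡ ∑ n (λ k → powℚ (u k) r)
H-∑ r zero    = refl
H-∑ r (suc n) = cong (_⊕ powℚ (u n) r) (H-∑ r n)

∑-linear₂ : ∀ n a b f g → ∑ n (λ k → a ⊗ f k ⊕ b ⊗ g k) ≡ a ⊗ ∑ n f ⊕ b ⊗ ∑ n g
∑-linear₂ n a b f g = trans (∑-⊕ n (λ k → a ⊗ f k) (λ k → b ⊗ g k)) (cong₂ _⊕_ (∑-⊗ n a f) (∑-⊗ n b g))

-- Both sides become (n + m + 1)! after multiplication by m! n!.
C-absorb : ∀ n m → suc m * ((n ℕ.+ suc m) C suc m) ≡ (n ℕ.+ suc m) * ((n ℕ.+ m) C m)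
C-absorb n m = ℕP.*-cancelʳ-≡ _ _ (m ! * n !) {{ℕP.m*n≢0 (m !) (n !) {{m ℕP.!≢0}} {{n ℕP.!≢0}}}} (begin
  suc m * c′ * (m ! * n !)               ≡⟨ rearr (suc m) c′ (m !) (n !) ⟩
  c′ * (suc m ! * n !)                   ≡⟨ cong (λ j → c′ * (suc m ! * j !)) (ℕP.m+n∸n≡m n (suc m)) ⟨
  c′ * (suc m ! * (n ℕ.+ suc m ∸ suc m) !)  ≡⟨ C-! (ℕP.m≤n+m (suc m) n) ⟩
  (n ℕ.+ suc m) !                        ≡⟨ cong _! (ℕP.+-suc n m) ⟩
  suc (n ℕ.+ m) * (n ℕ.+ m) !            ≡⟨ cong₂ _*_ (sym (ℕP.+-suc n m)) (sym (C-! (ℕP.m≤n+m m n))) ⟩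
  (n ℕ.+ suc m) * (c * (m ! * (n ℕ.+ m ∸ m) !))  ≡⟨ cong (λ j → (n ℕ.+ suc m) * (c * (m ! * j !))) (ℕP.m+n∸n≡m n m) ⟩
  (n ℕ.+ suc m) * (c * (m ! * n !))      ≡⟨ ℕP.*-assoc (n ℕ.+ suc m) c (m ! * n !) ⟨
  (n ℕ.+ suc m) * c * (m ! * n !)        ∎)
  where
  c c′ : ℕ
  c  = (n ℕ.+ m) C m
  c′ = (n ℕ.+ suc m) C suc m
  rearr : ∀ a b c d → a * b * (c * d) ≡ b * (a * c * d)
  rearr a b c d = trans (cong (_* (c * d)) (ℕP.*-comm a b)) (trans (ℕP.*-assoc b a (c * d)) (cong (b *_) (sym (ℕP.*-assoc a c d))))

-- Passing from m to m + 1 multiplies the binomial coefficient by (n + m + 1)/(m + 1) = 1 + n/(m +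
-- 1). The case n = p, m = p - 1 is C(2p-1,p-1).
C-∏ : ∀ n m → ν ((n ℕ.+ m) C m) ≡ ∏ m (λ k → 1ℚ ⊕ ν n ⊗ u k)
C-∏ n zero    = trans (cong ν (nC0≡1 (n ℕ.+ 0))) ν-1
C-∏ n (suc m) = ν-cancel m (begin
  ν (suc m) ⊗ ν ((n ℕ.+ suc m) C suc m)         ≡⟨ ν-* (suc m) _ ⟨
  ν (suc m * ((n ℕ.+ suc m) C suc m))           ≡⟨ cong ν (C-absorb n m) ⟩
  ν ((n ℕ.+ suc m) * ((n ℕ.+ m) C m))           ≡⟨ ν-* (n ℕ.+ suc m) _ ⟩
  ν (n ℕ.+ suc m) ⊗ ν ((n ℕ.+ m) C m)           ≡⟨ cong₂ _⊗_ (ν-+ n (suc m)) (C-∏ n m) ⟩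
  (ν n ⊕ ν (suc m)) ⊗ X                         ≡⟨ ring₁ (ν n) (ν (suc m)) X ⟩
  (1ℚ ⊗ ν n ⊕ ν (suc m)) ⊗ X                    ≡⟨ cong (λ z → (z ⊗ ν n ⊕ ν (suc m)) ⊗ X) (ν-u m) ⟨
  (ν (suc m) ⊗ u m ⊗ ν n ⊕ ν (suc m)) ⊗ X       ≡⟨ ring₂ (ν n) (ν (suc m)) X (u m) ⟩
  ν (suc m) ⊗ (X ⊗ (1ℚ ⊕ ν n ⊗ u m))            ∎)
  where
  X = ∏ m (λ k → 1ℚ ⊕ ν n ⊗ u k)
  ring₁ : ∀ n m x → (n ⊕ m) ⊗ x ≡ (1ℚ ⊗ n ⊕ m) ⊗ x
  ring₁ = solve-∀ ringℚ
  ring₂ : ∀ n m x u → (m ⊗ u ⊗ n ⊕ m) ⊗ x ≡ m ⊗ (x ⊗ (1ℚ ⊕ n ⊗ u))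
  ring₂ = solve-∀ ringℚ

∏-1 : ∀ n → ∏ n (λ _ → 1ℚ) ≡ 1ℚ
∏-1 zero    = refl
∏-1 (suc n) = trans (ℚP.*-identityʳ (∏ n (λ _ → 1ℚ))) (∏-1 n)

-- For u = 1/K and v = 1/(p - K). Cubing v = -u + p w leaves 3 p u² w as the term of lowest order in
-- p, and w = -u² + p u w turns it into -3 p u^4 plus a multiple of p².
cube-sum : ∀ {u v w p} → u ⊕ v ≡ p ⊗ (u ⊗ v) → w ≡ u ⊗ v →
  powℚ u 3 ⊕ powℚ v 3 ≡ ⊝ (1ℚ ⊕ 1ℚ ⊕ 1ℚ) ⊗ p ⊗ powℚ u 4 ⊕ p ⊗ p ⊗ ((1ℚ ⊕ 1ℚ ⊕ 1ℚ) ⊗ u ⊗ w ⊗ (u ⊗ u ⊕ ⊝ w) ⊕ p ⊗ w ⊗ w ⊗ w)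
cube-sum {u} {v} {w} {p} e refl = begin
  powℚ u 3 ⊕ powℚ v 3
    ≡⟨ cong (λ z → powℚ u 3 ⊕ powℚ z 3) v≡ ⟩
  powℚ u 3 ⊕ powℚ (⊝ u ⊕ p ⊗ w) 3
    ≡⟨ ring₂ u w p ⟩
  (1ℚ ⊕ 1ℚ ⊕ 1ℚ) ⊗ p ⊗ u ⊗ u ⊗ w ⊕ (⊝ (1ℚ ⊕ 1ℚ ⊕ 1ℚ) ⊗ p ⊗ p ⊗ u ⊗ w ⊗ w ⊕ p ⊗ p ⊗ p ⊗ w ⊗ w ⊗ w)
    ≡⟨ cong (λ z → (1ℚ ⊕ 1ℚ ⊕ 1ℚ) ⊗ p ⊗ u ⊗ u ⊗ z ⊕ (⊝ (1ℚ ⊕ 1ℚ ⊕ 1ℚ) ⊗ p ⊗ p ⊗ u ⊗ w ⊗ w ⊕ p ⊗ p ⊗ p ⊗ w ⊗ w ⊗ w)) w≡ ⟩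
  (1ℚ ⊕ 1ℚ ⊕ 1ℚ) ⊗ p ⊗ u ⊗ u ⊗ (u ⊗ (⊝ u ⊕ p ⊗ w)) ⊕ (⊝ (1ℚ ⊕ 1ℚ ⊕ 1ℚ) ⊗ p ⊗ p ⊗ u ⊗ w ⊗ w ⊕ p ⊗ p ⊗ p ⊗ w ⊗ w ⊗ w)
    ≡⟨ ring₃ u w p ⟩
  ⊝ (1ℚ ⊕ 1ℚ ⊕ 1ℚ) ⊗ p ⊗ powℚ u 4 ⊕ p ⊗ p ⊗ ((1ℚ ⊕ 1ℚ ⊕ 1ℚ) ⊗ u ⊗ w ⊗ (u ⊗ u ⊕ ⊝ w) ⊕ p ⊗ w ⊗ w ⊗ w)
    ∎
  where
  ring₁ : ∀ u v → v ≡ ⊝ u ⊕ (u ⊕ v)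
  ring₁ = solve-∀ ringℚ
  v≡ : v ≡ ⊝ u ⊕ p ⊗ (u ⊗ v)
  v≡ = trans (ring₁ u v) (cong (⊝ u ⊕_) e)
  w≡ : u ⊗ v ≡ u ⊗ (⊝ u ⊕ p ⊗ (u ⊗ v))
  w≡ = cong (u ⊗_) v≡
  ring₂ : ∀ u w p → u ⊗ (u ⊗ (u ⊗ 1ℚ)) ⊕ (⊝ u ⊕ p ⊗ w) ⊗ ((⊝ u ⊕ p ⊗ w) ⊗ ((⊝ u ⊕ p ⊗ w) ⊗ 1ℚ)) ≡
    (1ℚ ⊕ 1ℚ ⊕ 1ℚ) ⊗ p ⊗ u ⊗ u ⊗ w ⊕ (⊝ (1ℚ ⊕ 1ℚ ⊕ 1ℚ) ⊗ p ⊗ p ⊗ u ⊗ w ⊗ w ⊕ p ⊗ p ⊗ p ⊗ w ⊗ w ⊗ w)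
  ring₂ = solve-∀ ringℚ
  ring₃ : ∀ u w p → (1ℚ ⊕ 1ℚ ⊕ 1ℚ) ⊗ p ⊗ u ⊗ u ⊗ (u ⊗ (⊝ u ⊕ p ⊗ w)) ⊕ (⊝ (1ℚ ⊕ 1ℚ ⊕ 1ℚ) ⊗ p ⊗ p ⊗ u ⊗ w ⊗ w ⊕ p ⊗ p ⊗ p ⊗ w ⊗ w ⊗ w) ≡
    ⊝ (1ℚ ⊕ 1ℚ ⊕ 1ℚ) ⊗ p ⊗ (u ⊗ (u ⊗ (u ⊗ (u ⊗ 1ℚ)))) ⊕ p ⊗ p ⊗ ((1ℚ ⊕ 1ℚ ⊕ 1ℚ) ⊗ u ⊗ w ⊗ (u ⊗ u ⊕ ⊝ w) ⊕ p ⊗ w ⊗ w ⊗ w)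
  ring₃ = solve-∀ ringℚ

-- u + v - p u v = 0 is multiplied by 1 + p u + p² u² + p³ u³.
sum-expansion : ∀ {u v p} → u ⊕ v ≡ p ⊗ (u ⊗ v) →
  powℚ u 1 ⊕ powℚ v 1 ≡ ⊝ p ⊗ powℚ u 2 ⊕ ⊝ (p ⊗ p) ⊗ (1ℚ ⊗ powℚ u 3 ⊕ p ⊗ (1ℚ ⊗ powℚ u 4 ⊕ ⊝ p ⊗ (powℚ u 4 ⊗ v)))
sum-expansion {u} {v} {p} e = begin
  powℚ u 1 ⊕ powℚ v 1
    ≡⟨ ring₁ u v p ⟩
  R ⊕ (u ⊕ v ⊕ ⊝ (p ⊗ (u ⊗ v))) ⊗ q
    ≡⟨ cong (λ z → R ⊕ (z ⊕ ⊝ (p ⊗ (u ⊗ v))) ⊗ q) e ⟩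
  R ⊕ (p ⊗ (u ⊗ v) ⊕ ⊝ (p ⊗ (u ⊗ v))) ⊗ q
    ≡⟨ ring₂ R (p ⊗ (u ⊗ v)) q ⟩
  R ∎
  where
  q = 1ℚ ⊕ p ⊗ u ⊕ p ⊗ p ⊗ u ⊗ u ⊕ p ⊗ p ⊗ p ⊗ u ⊗ u ⊗ u
  R = ⊝ p ⊗ powℚ u 2 ⊕ ⊝ (p ⊗ p) ⊗ (1ℚ ⊗ powℚ u 3 ⊕ p ⊗ (1ℚ ⊗ powℚ u 4 ⊕ ⊝ p ⊗ (powℚ u 4 ⊗ v)))
  ring₁ : ∀ u v p → u ⊗ 1ℚ ⊕ v ⊗ 1ℚ ≡
    ⊝ p ⊗ (u ⊗ (u ⊗ 1ℚ)) ⊕ ⊝ (p ⊗ p) ⊗ (1ℚ ⊗ (u ⊗ (u ⊗ (u ⊗ 1ℚ))) ⊕ p ⊗ (1ℚ ⊗ (u ⊗ (u ⊗ (u ⊗ (u ⊗ 1ℚ)))) ⊕ ⊝ p ⊗ (u ⊗ (u ⊗ (u ⊗ (u ⊗ 1ℚ))) ⊗ v)))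
    ⊕ (u ⊕ v ⊕ ⊝ (p ⊗ (u ⊗ v))) ⊗ (1ℚ ⊕ p ⊗ u ⊕ p ⊗ p ⊗ u ⊗ u ⊕ p ⊗ p ⊗ p ⊗ u ⊗ u ⊗ u)
  ring₁ = solve-∀ ringℚ
  ring₂ : ∀ r x q → r ⊕ (x ⊕ ⊝ x) ⊗ q ≡ r
  ring₂ = solve-∀ ringℚ

-- The localisation of ℤ at p and congruences modulo p^e.

module Adic (p : ℕ) (isPrime : Prime p) where

  P : ℚ
  P = ν p

  -- Z is the localisation of ℤ at p, and D e is p^e Z.
  record Z (x : ℚ) : Set where
    constructor mkZ
    field
      den    : ℕ
      p∤den  : ¬ p ∣ den
      num    : ℤ
      den⊗x≡num : ν den ⊗ x ≡ ι num

  record D (e : ℕ) (x : ℚ) : Set where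
    constructor mkD
    field
      quot    : ℚ
      Z-quot  : Z quot
      x≡Pᵉ⊗quot : x ≡ powℚ P e ⊗ quot

  p∤1 : ¬ p ∣ 1
  p∤1 h = contradiction (∣1⇒≡1 h) (ℕ.nonTrivial⇒≢1 {{prime⇒nonTrivial isPrime}})

  p∤* : ∀ {m n} → ¬ p ∣ m → ¬ p ∣ n → ¬ p ∣ m * n
  p∤* {m} {n} h k = [ h , k ]′ ∘ euclidsLemma m n isPrime

  Z-ι : ∀ a → Z (ι a)
  Z-ι a = mkZ 1 p∤1 a (trans (cong (_⊗ ι a) ν-1) (ℚP.*-identityˡ (ι a)))

  Z-ν : ∀ n → Z (ν n)
  Z-ν n = Z-ι (+ n)

  Z-0 : Z 0ℚ
  Z-0 = subst Z ν-0 (Z-ν 0)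

  Z-1 : Z 1ℚ
  Z-1 = subst Z ν-1 (Z-ν 1)

  Z-⊕ : ∀ {x y} → Z x → Z y → Z (x ⊕ y)
  Z-⊕ {x} {y} (mkZ d hd a ea) (mkZ f hf b eb) = mkZ (d * f) (p∤* hd hf) (+ f ℤ.* a ℤ.+ + d ℤ.* b) (begin
    ν (d * f) ⊗ (x ⊕ y)                         ≡⟨ cong (_⊗ (x ⊕ y)) (ν-* d f) ⟩
    ν d ⊗ ν f ⊗ (x ⊕ y)                         ≡⟨ ring (ν d) (ν f) x y ⟩
    ν f ⊗ (ν d ⊗ x) ⊕ ν d ⊗ (ν f ⊗ y)           ≡⟨ cong₂ (λ s t → ν f ⊗ s ⊕ ν d ⊗ t) ea eb ⟩
    ν f ⊗ ι a ⊕ ν d ⊗ ι b                       ≡⟨ cong₂ _⊕_ (ι-* (+ f) a) (ι-* (+ d) b) ⟨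
    ι (+ f ℤ.* a) ⊕ ι (+ d ℤ.* b)               ≡⟨ ι-+ _ _ ⟨
    ι (+ f ℤ.* a ℤ.+ + d ℤ.* b)                 ∎)
    where
    ring : ∀ d f x y → d ⊗ f ⊗ (x ⊕ y) ≡ f ⊗ (d ⊗ x) ⊕ d ⊗ (f ⊗ y)
    ring = solve-∀ ringℚ

  Z-⊗ : ∀ {x y} → Z x → Z y → Z (x ⊗ y)
  Z-⊗ {x} {y} (mkZ d hd a ea) (mkZ f hf b eb) = mkZ (d * f) (p∤* hd hf) (a ℤ.* b) (begin
    ν (d * f) ⊗ (x ⊗ y)         ≡⟨ cong (_⊗ (x ⊗ y)) (ν-* d f) ⟩
    ν d ⊗ ν f ⊗ (x ⊗ y)         ≡⟨ ring (ν d) (ν f) x y ⟩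
    ν d ⊗ x ⊗ (ν f ⊗ y)         ≡⟨ cong₂ _⊗_ ea eb ⟩
    ι a ⊗ ι b                   ≡⟨ ι-* a b ⟨
    ι (a ℤ.* b)                 ∎)
    where
    ring : ∀ d f x y → d ⊗ f ⊗ (x ⊗ y) ≡ d ⊗ x ⊗ (f ⊗ y)
    ring = solve-∀ ringℚ

  Z-⊝ : ∀ {x} → Z x → Z (⊝ x)
  Z-⊝ {x} (mkZ d hd a ea) = mkZ d hd (ℤ.- a) (trans (sym (ℚP.neg-distribʳ-* (ν d) x)) (trans (cong ⊝_ ea) (sym (ι-neg a))))

  Z-pow : ∀ {x} → Z x → ∀ n → Z (powℚ x n)
  Z-pow h zero    = Z-1
  Z-pow h (suc n) = Z-⊗ h (Z-pow h n)

  Z-u : ∀ {k} → ¬ p ∣ suc k → Z (u k)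
  Z-u {k} h = mkZ (suc k) h (+ 1) (trans (ν-u k) (sym ν-1))

  Z-P : Z P
  Z-P = Z-ν p

  D-⊕ : ∀ {e x y} → D e x → D e y → D e (x ⊕ y)
  D-⊕ {e} (mkD a za ea) (mkD b zb eb) = mkD (a ⊕ b) (Z-⊕ za zb) (trans (cong₂ _⊕_ ea eb) (sym (ℚP.*-distribˡ-+ (powℚ P e) a b)))

  D-⊝ : ∀ {e x} → D e x → D e (⊝ x)
  D-⊝ {e} (mkD a za ea) = mkD (⊝ a) (Z-⊝ za) (trans (cong ⊝_ ea) (ℚP.neg-distribʳ-* (powℚ P e) a))

  D-⊗ : ∀ {e f x y} → D e x → D f y → D (e ℕ.+ f) (x ⊗ y)
  D-⊗ {e} {f} {x} {y} (mkD a za ea) (mkD b zb eb) = mkD (a ⊗ b) (Z-⊗ za zb) (begin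
    x ⊗ y                               ≡⟨ cong₂ _⊗_ ea eb ⟩
    powℚ P e ⊗ a ⊗ (powℚ P f ⊗ b)       ≡⟨ ring (powℚ P e) a (powℚ P f) b ⟩
    powℚ P e ⊗ powℚ P f ⊗ (a ⊗ b)       ≡⟨ cong (_⊗ (a ⊗ b)) (pow-+ P e f) ⟨
    powℚ P (e ℕ.+ f) ⊗ (a ⊗ b)          ∎)
    where
    ring : ∀ p a q b → p ⊗ a ⊗ (q ⊗ b) ≡ p ⊗ q ⊗ (a ⊗ b)
    ring = solve-∀ ringℚ

  Z⇒D : ∀ {x} → Z x → D 0 x
  Z⇒D {x} z = mkD x z (sym (ℚP.*-identityˡ x))

  D⇒Z : ∀ {e x} → D e x → Z x
  D⇒Z {e} (mkD y z refl) = Z-⊗ (Z-pow Z-P e) z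

  D-Z : ∀ {e x y} → D e x → Z y → D e (x ⊗ y)
  D-Z {e} {x} {y} h z = subst (λ k → D k (x ⊗ y)) (ℕP.+-identityʳ e) (D-⊗ h (Z⇒D z))

  Z-D : ∀ {e x y} → Z x → D e y → D e (x ⊗ y)
  Z-D z h = D-⊗ (Z⇒D z) h

  D-pow : ∀ e → D e (powℚ P e)
  D-pow e = mkD 1ℚ Z-1 (sym (ℚP.*-identityʳ (powℚ P e)))

  D-P : D 1 P
  D-P = subst (D 1) (ℚP.*-identityʳ P) (D-pow 1)

  D-weaken : ∀ {e f x} → f ≤ e → D e x → D f x
  D-weaken {e} {f} {x} f≤e (mkD y z r) = mkD (powℚ P (e ∸ f) ⊗ y) (Z-⊗ (Z-pow Z-P (e ∸ f)) z) (begin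
    x                                      ≡⟨ r ⟩
    powℚ P e ⊗ y                           ≡⟨ cong (λ k → powℚ P k ⊗ y) (ℕP.m+[n∸m]≡n f≤e) ⟨
    powℚ P (f ℕ.+ (e ∸ f)) ⊗ y             ≡⟨ cong (_⊗ y) (pow-+ P f (e ∸ f)) ⟩
    powℚ P f ⊗ powℚ P (e ∸ f) ⊗ y          ≡⟨ ℚP.*-assoc (powℚ P f) _ y ⟩
    powℚ P f ⊗ (powℚ P (e ∸ f) ⊗ y)        ∎)

  D-0 : ∀ {e} → D e 0ℚ
  D-0 {e} = mkD 0ℚ Z-0 (sym (ℚP.*-zeroʳ (powℚ P e)))

  D-cancel-unit : ∀ {e x} k → ¬ p ∣ suc k → D e (ν (suc k) ⊗ x) → D e x
  D-cancel-unit {e} {x} k h d = subst (D e) eq (Z-D (Z-u h) d)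
    where
    eq : u k ⊗ (ν (suc k) ⊗ x) ≡ x
    eq = ν-cancel k (trans (sym (ℚP.*-assoc (ν (suc k)) (u k) (ν (suc k) ⊗ x)))
           (trans (cong (_⊗ (ν (suc k) ⊗ x)) (ν-u k)) (ℚP.*-identityˡ (ν (suc k) ⊗ x))))

  P-cancel : ∀ {x y} → P ⊗ x ≡ P ⊗ y → x ≡ y
  P-cancel {x} {y} e = ν-cancel (ℕ.pred p) (subst (λ k → ν k ⊗ x ≡ ν k ⊗ y) (sym (ℕP.suc-pred p {{prime⇒nonZero isPrime}})) e)

  D-cancel-P : ∀ {e x} → D (suc e) (P ⊗ x) → D e x
  D-cancel-P {e} (mkD y z r) = mkD y z (P-cancel (trans r (ℚP.*-assoc P (powℚ P e) y)))

  D-P⊗ : ∀ {e x} → D e x → D (suc e) (P ⊗ x)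
  D-P⊗ = D-⊗ D-P

  -- d is coprime to the irreducible p, hence to p^e, one factor p at a time.
  coprime-pow : ∀ {d} e → ¬ p ∣ d → ∀ {n} → p ^ e ∣ d * n → p ^ e ∣ n
  coprime-pow {d} e p∤d = coprime-divisor (co e)
    where
    cop : Coprime d p
    cop (i∣d , i∣p) with prime⇒irreducible isPrime i∣p
    ... | inj₁ i≡1  = i≡1
    ... | inj₂ refl = contradiction i∣d p∤d
    co : ∀ e → Coprime (p ^ e) d
    co zero    (i∣1 , _)   = ∣1⇒≡1 i∣1
    co (suc e) {i} (i∣pp , i∣d) = co e (coprime-divisor (λ (j∣i , j∣p) → cop (∣-trans j∣i i∣d , j∣p)) i∣pp , i∣d)

  -- Clearing denominators gives d n = m a p^e in ℤ, where a/d is the quotient of x by p^e and d is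
  -- prime to p.
  D⇒∣ : ∀ {e x} m {n} → ν m ⊗ x ≡ ι n → D e x → p ^ e ∣ ∣ n ∣
  D⇒∣ {e} {x} m {n} t (mkD y (mkZ d p∤d a r) s) = coprime-pow e p∤d (divides (∣ + m ℤ.* a ∣) (begin
    d * ∣ n ∣                                   ≡⟨ ℤP.abs-* (+ d) n ⟨
    ∣ + d ℤ.* n ∣                               ≡⟨ cong ∣_∣ (ι-injective eq) ⟩
    ∣ + m ℤ.* a ℤ.* + (p ^ e) ∣                 ≡⟨ ℤP.abs-* (+ m ℤ.* a) _ ⟩
    ∣ + m ℤ.* a ∣ * p ^ e                       ∎))
    where
    ring : ∀ d n q y → d ⊗ (n ⊗ (q ⊗ y)) ≡ n ⊗ (d ⊗ y) ⊗ q
    ring = solve-∀ ringℚ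
    eq : ι (+ d ℤ.* n) ≡ ι (+ m ℤ.* a ℤ.* + (p ^ e))
    eq = begin
      ι (+ d ℤ.* n)                              ≡⟨ ι-* (+ d) n ⟩
      ν d ⊗ ι n                                  ≡⟨ cong (ν d ⊗_) t ⟨
      ν d ⊗ (ν m ⊗ x)                            ≡⟨ cong (λ z → ν d ⊗ (ν m ⊗ z)) s ⟩
      ν d ⊗ (ν m ⊗ (powℚ P e ⊗ y))               ≡⟨ ring (ν d) (ν m) (powℚ P e) y ⟩
      ν m ⊗ (ν d ⊗ y) ⊗ powℚ P e                 ≡⟨ cong₂ (λ s t → ν m ⊗ s ⊗ t) r (sym (ν-^ p e)) ⟩
      ν m ⊗ ι a ⊗ ν (p ^ e)                      ≡⟨ cong (_⊗ ν (p ^ e)) (ι-* (+ m) a) ⟨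
      ι (+ m ℤ.* a) ⊗ ν (p ^ e)                  ≡⟨ ι-* (+ m ℤ.* a) (+ (p ^ e)) ⟨
      ι (+ m ℤ.* a ℤ.* + (p ^ e))                ∎

  ∣⇒D-ι : ∀ {e} i → p ^ e ∣ ∣ i ∣ → D e (ι i)
  ∣⇒D-ι {e} i (divides q r) with ∣i∣≡ i
    where
    ∣i∣≡ : ∀ i → ∃ λ s → i ≡ s ℤ.* + ∣ i ∣
    ∣i∣≡ (+ n)      = + 1 , sym (ℤP.*-identityˡ (+ n))
    ∣i∣≡ -[1+ n ]   = -[1+ 0 ] , sym (ℤP.-1*i≡-i (+ suc n))
  -- `s` is the sign of i, as the divisibility only concerns the absolute value.
  ... | s , eq = mkD (ι (s ℤ.* + q)) (Z-ι (s ℤ.* + q)) (begin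
    ι i                                ≡⟨ cong ι eq ⟩
    ι (s ℤ.* + ∣ i ∣)                  ≡⟨ ι-* s (+ ∣ i ∣) ⟩
    ι s ⊗ ν ∣ i ∣                      ≡⟨ cong (λ n → ι s ⊗ ν n) r ⟩
    ι s ⊗ ν (q * p ^ e)                ≡⟨ cong (ι s ⊗_) (ν-* q (p ^ e)) ⟩
    ι s ⊗ (ν q ⊗ ν (p ^ e))            ≡⟨ cong (λ t → ι s ⊗ (ν q ⊗ t)) (ν-^ p e) ⟩
    ι s ⊗ (ν q ⊗ powℚ P e)             ≡⟨ ring (ι s) (ν q) (powℚ P e) ⟩
    powℚ P e ⊗ (ι s ⊗ ν q)             ≡⟨ cong (powℚ P e ⊗_) (ι-* s (+ q)) ⟨
    powℚ P e ⊗ ι (s ℤ.* + q)           ∎)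
    where
    ring : ∀ s q p → s ⊗ (q ⊗ p) ≡ p ⊗ (s ⊗ q)
    ring = solve-∀ ringℚ

  -- As the exponent is positive, p divides the numerator; in lowest terms it then does not divide
  -- the denominator, which is thus a unit of `Z`.
  ∣↥⇒D : ∀ {e x} → p ^ suc e ∣ ∣ ↥ x ∣ → D (suc e) x
  ∣↥⇒D {e} {x@(mkℚ n d c)} h = D-cancel-unit d p∤↧ (subst (D (suc e)) (sym (ι-↥ x)) (∣⇒D-ι n h))
    where
    p∤↧ : ¬ p ∣ suc d
    p∤↧ h′ = p∤1 (subst (p ∣_) (co (∣-trans (m∣m*n (p ^ e)) h , h′)) ∣-refl)
      where
      co : Coprime ∣ n ∣ (suc d)
      -- The coprimality stored in a rational is irrelevant and has to be recomputed.
      co {i} = recompute c {i}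

  ∣↥⇔D : ∀ e x → (p ^ suc e ∣ ∣ ↥ x ∣) ⇔ D (suc e) x
  ∣↥⇔D e x = mk⇔ (∣↥⇒D {e} {x}) (D⇒∣ (↧ₙ x) (ι-↥ x))

  ∣⇔D-ι : ∀ e i → (p ^ e ∣ ∣ i ∣) ⇔ D e (ι i)
  ∣⇔D-ι e i = mk⇔ (∣⇒D-ι {e} i) (D⇒∣ 1 (trans (cong (_⊗ ι i) ν-1) (ℚP.*-identityˡ (ι i))))

  D-∑ : ∀ {e} n {f} → (∀ k → k < n → D e (f k)) → D e (∑ n f)
  D-∑ zero    df = D-0
  D-∑ (suc n) df = D-⊕ (D-∑ n (λ k k<n → df k (ℕP.m<n⇒m<1+n k<n))) (df n (ℕP.n<1+n n))

  Z-∑ : ∀ n {f} → (∀ k → k < n → Z (f k)) → Z (∑ n f)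
  Z-∑ n zf = D⇒Z (D-∑ {0} n (λ k k<n → Z⇒D (zf k k<n)))

  -- A record rather than a synonym, so that x and y can be inferred from the type.
  record Cong (e : ℕ) (x y : ℚ) : Set where
    constructor mkCong
    field
      D-diff : D e (x ⊕ ⊝ y)
  open Cong public

  D-Congˡ : ∀ {e x y} → Cong e x y → D e y → D e x
  D-Congˡ {e} {x} {y} (mkCong d) dy = subst (D e) (ring x y) (D-⊕ d dy)
    where
    ring : ∀ x y → x ⊕ ⊝ y ⊕ y ≡ x
    ring = solve-∀ ringℚ

  Cong-sym : ∀ {e x y} → Cong e x y → Cong e y x
  Cong-sym {e} {x} {y} (mkCong d) = mkCong (subst (D e) (ring x y) (D-⊝ d))
    where
    ring : ∀ x y → ⊝ (x ⊕ ⊝ y) ≡ y ⊕ ⊝ x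
    ring = solve-∀ ringℚ

  Cong-refl : ∀ {e x} → Cong e x x
  Cong-refl {e} {x} = mkCong (subst (D e) (sym (ℚP.+-inverseʳ x)) D-0)

  Cong-trans : ∀ {e x y z} → Cong e x y → Cong e y z → Cong e x z
  Cong-trans {e} {x} {y} {z} (mkCong d) (mkCong d′) = mkCong (subst (D e) (ring x y z) (D-⊕ d d′))
    where
    ring : ∀ x y z → x ⊕ ⊝ y ⊕ (y ⊕ ⊝ z) ≡ x ⊕ ⊝ z
    ring = solve-∀ ringℚ

  D-Congʳ : ∀ {e x y} → Cong e x y → D e x → D e y
  D-Congʳ = D-Congˡ ∘ Cong-sym

  Cong-weaken : ∀ {e f x y} → f ≤ e → Cong e x y → Cong f x y
  Cong-weaken f≤e (mkCong d) = mkCong (D-weaken f≤e d)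

  -- Induction by xy - 1 = (x - 1)(y - 1) + (x - 1) + (y - 1).
  ∏-Cong-1 : ∀ {e f} n → (∀ k → k < n → Cong e (f k) 1ℚ) → Cong e (∏ n f) 1ℚ
  ∏-Cong-1 zero    c = Cong-refl
  ∏-Cong-1 {e} {f} (suc n) c = mkCong (subst (D e) (ring (∏ n f) (f n)) (D-⊕ (D-⊕ (D-Z dp (D⇒Z df)) dp) df))
    where
    dp = D-diff (∏-Cong-1 {e} {f} n (λ k k<n → c k (ℕP.m<n⇒m<1+n k<n)))
    df = D-diff (c n (ℕP.n<1+n n))
    ring : ∀ x y → (x ⊕ ⊝ 1ℚ) ⊗ (y ⊕ ⊝ 1ℚ) ⊕ (x ⊕ ⊝ 1ℚ) ⊕ (y ⊕ ⊝ 1ℚ) ≡ x ⊗ y ⊕ ⊝ 1ℚ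
    ring = solve-∀ ringℚ

  -- What follows the linear term of the binomial expansion is divisible by y²; this controls x^p -
  -- 1 in `Cong-pow-p`.
  pow-1+ : ∀ {y} → Z y → ∀ n → ∃ λ r → Z r × powℚ (1ℚ ⊕ y) n ≡ 1ℚ ⊕ ν n ⊗ y ⊕ y ⊗ y ⊗ r
  pow-1+ {y} zy zero    = 0ℚ , Z-0 , sym (trans (cong (λ z → 1ℚ ⊕ z ⊗ y ⊕ y ⊗ y ⊗ 0ℚ) ν-0) (ring y))
    where
    ring : ∀ y → 1ℚ ⊕ 0ℚ ⊗ y ⊕ y ⊗ y ⊗ 0ℚ ≡ 1ℚ
    ring = solve-∀ ringℚ
  pow-1+ {y} zy (suc n) with pow-1+ zy n
  ... | r , zr , eq = ν n ⊕ r ⊕ y ⊗ r , Z-⊕ (Z-⊕ (Z-ν n) zr) (Z-⊗ zy zr) , (begin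
    (1ℚ ⊕ y) ⊗ powℚ (1ℚ ⊕ y) n                                          ≡⟨ cong ((1ℚ ⊕ y) ⊗_) eq ⟩
    (1ℚ ⊕ y) ⊗ (1ℚ ⊕ ν n ⊗ y ⊕ y ⊗ y ⊗ r)                               ≡⟨ ring y (ν n) r ⟩
    1ℚ ⊕ (1ℚ ⊕ ν n) ⊗ y ⊕ y ⊗ y ⊗ (ν n ⊕ r ⊕ y ⊗ r)                     ≡⟨ cong (λ z → 1ℚ ⊕ z ⊗ y ⊕ y ⊗ y ⊗ (ν n ⊕ r ⊕ y ⊗ r)) (ν-suc n) ⟨
    1ℚ ⊕ ν (suc n) ⊗ y ⊕ y ⊗ y ⊗ (ν n ⊕ r ⊕ y ⊗ r)                      ∎)
    where
    ring : ∀ y n r → (1ℚ ⊕ y) ⊗ (1ℚ ⊕ n ⊗ y ⊕ y ⊗ y ⊗ r) ≡ 1ℚ ⊕ (1ℚ ⊕ n) ⊗ y ⊕ y ⊗ y ⊗ (n ⊕ r ⊕ y ⊗ r)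
    ring = solve-∀ ringℚ

  -- With x = 1 + y, x^p - 1 = p y + y² r. The first term gains the factor p, and y² lies in
  -- p^(2e+2) Z, hence in p^(e+2) Z.
  Cong-pow-p : ∀ {e x} → Cong (suc e) x 1ℚ → Cong (suc (suc e)) (powℚ x p) 1ℚ
  Cong-pow-p {e} {x} (mkCong d) = mkCong (subst (D (suc (suc e))) (sym eq)
    (D-⊕ (D-P⊗ d) (D-Z (D-weaken
      (s≤s (subst (_≤ e ℕ.+ suc e) (ℕP.+-comm e 1) (ℕP.+-monoʳ-≤ e (s≤s z≤n)))) (D-⊗ d d)) (proj₁ (proj₂ expand)))))
    where
    y = x ⊕ ⊝ 1ℚ
    expand = pow-1+ (D⇒Z d) p
    r = proj₁ expand
    ring₁ : ∀ x → x ≡ 1ℚ ⊕ (x ⊕ ⊝ 1ℚ)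
    ring₁ = solve-∀ ringℚ
    ring₂ : ∀ a b → 1ℚ ⊕ a ⊕ b ⊕ ⊝ 1ℚ ≡ a ⊕ b
    ring₂ = solve-∀ ringℚ
    eq : powℚ x p ⊕ ⊝ 1ℚ ≡ P ⊗ y ⊕ y ⊗ y ⊗ r
    eq = begin
      powℚ x p ⊕ ⊝ 1ℚ                       ≡⟨ cong (λ z → powℚ z p ⊕ ⊝ 1ℚ) (ring₁ x) ⟩
      powℚ (1ℚ ⊕ y) p ⊕ ⊝ 1ℚ                ≡⟨ cong (_⊕ ⊝ 1ℚ) (proj₂ (proj₂ expand)) ⟩
      1ℚ ⊕ P ⊗ y ⊕ y ⊗ y ⊗ r ⊕ ⊝ 1ℚ         ≡⟨ ring₂ (P ⊗ y) (y ⊗ y ⊗ r) ⟩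
      P ⊗ y ⊕ y ⊗ y ⊗ r                     ∎

  -- e is the second elementary symmetric function of the c k; Newton's identity for it is doubled
  -- to avoid a division. A new factor adds s c to e, where s is the sum so far.
  ∏-expand : ∀ {x c} n → Z x → (∀ k → k < n → Z (c k)) → ∃ λ e → ∃ λ r → Z e × Z r
    × (e ⊕ e ≡ ∑ n c ⊗ ∑ n c ⊕ ⊝ ∑ n (λ k → c k ⊗ c k))
    × (∏ n (λ k → 1ℚ ⊕ x ⊗ c k) ≡ 1ℚ ⊕ x ⊗ ∑ n c ⊕ x ⊗ x ⊗ e ⊕ x ⊗ x ⊗ x ⊗ r)
  ∏-expand {x} zero zx zc = 0ℚ , 0ℚ , Z-0 , Z-0 , refl , ring x
    where
    ring : ∀ x → 1ℚ ≡ 1ℚ ⊕ x ⊗ 0ℚ ⊕ x ⊗ x ⊗ 0ℚ ⊕ x ⊗ x ⊗ x ⊗ 0ℚ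
    ring = solve-∀ ringℚ
  ∏-expand {x} {c} (suc n) zx zc with ∏-expand n zx (λ k k<n → zc k (ℕP.m<n⇒m<1+n k<n))
  ... | e , r , ze , zr , eqe , eq∏ = e ⊕ s ⊗ c n , r ⊕ e ⊗ c n ⊕ x ⊗ r ⊗ c n
    , Z-⊕ ze (Z-⊗ zs zcn) , Z-⊕ (Z-⊕ zr (Z-⊗ ze zcn)) (Z-⊗ (Z-⊗ zx zr) zcn)
    , trans (ring₁ e (s ⊗ c n)) (trans (cong (_⊕ (s ⊗ c n ⊕ s ⊗ c n)) eqe) (ring₂ s (c n) _))
    , trans (cong (_⊗ (1ℚ ⊕ x ⊗ c n)) eq∏) (ring₃ x s e r (c n))
    where
    s = ∑ n c
    zcn = zc n (ℕP.n<1+n n)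
    zs = Z-∑ n (λ k k<n → zc k (ℕP.m<n⇒m<1+n k<n))
    ring₁ : ∀ e t → e ⊕ t ⊕ (e ⊕ t) ≡ e ⊕ e ⊕ (t ⊕ t)
    ring₁ = solve-∀ ringℚ
    ring₂ : ∀ s c q → s ⊗ s ⊕ ⊝ q ⊕ (s ⊗ c ⊕ s ⊗ c) ≡ (s ⊕ c) ⊗ (s ⊕ c) ⊕ ⊝ (q ⊕ c ⊗ c)
    ring₂ = solve-∀ ringℚ
    ring₃ : ∀ x s e r c → (1ℚ ⊕ x ⊗ s ⊕ x ⊗ x ⊗ e ⊕ x ⊗ x ⊗ x ⊗ r) ⊗ (1ℚ ⊕ x ⊗ c) ≡
      1ℚ ⊕ x ⊗ (s ⊕ c) ⊕ x ⊗ x ⊗ (e ⊕ s ⊗ c) ⊕ x ⊗ x ⊗ x ⊗ (r ⊕ e ⊗ c ⊕ x ⊗ r ⊗ c)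
    ring₃ = solve-∀ ringℚ

  D-cancel-neg-P : ∀ {e x} → D (suc e) (⊝ P ⊗ x) → D e x
  D-cancel-neg-P {e} {x} d = D-cancel-P (subst (D (suc e)) (ring P x) (D-⊝ d))
    where
    ring : ∀ p x → ⊝ (⊝ p ⊗ x) ≡ p ⊗ x
    ring = solve-∀ ringℚ

-- Divisibility by p and the factors in Faulhaber's formula, where h = p - 1.

module Wolstenholme (h : ℕ) (isPrime : Prime (suc h)) (7≤p : 7 ≤ suc h) where

  open Adic (suc h) isPrime

  p : ℕ
  p = suc h

  p∤< : ∀ {k} → suc k < p → ¬ p ∣ suc k
  p∤< k<p p∣k = ℕP.<⇒≱ k<p (∣⇒≤ p∣k)

  p∤! : ∀ k → k < p → p ∤ k !
  p∤! zero    _   = p∤1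
  p∤! (suc k) k<p = p∤* (p∤< k<p) (p∤! k (ℕP.<-trans (ℕP.n<1+n k) k<p))

  -- p divides p! = C(p,k+1) (k+1)! (p-k-1)! but neither of the two factorials.
  p∣C : ∀ k → suc k < p → p ∣ p C suc k
  p∣C k k<p with euclidsLemma (p C suc k) (suc k ! * (p ∸ suc k) !) isPrime (subst (p ∣_) (sym (C-! (ℕP.<⇒≤ k<p))) (m∣m*n (h !)))
  ... | inj₁ p∣c = p∣c
  ... | inj₂ p∣d = contradiction p∣d (p∤* (p∤! (suc k) k<p) (p∤! (h ∸ k) (s≤s (ℕP.m∸n≤m h k))))

  -- The valuation of k + 1 is at most e.
  Z-powP⊗u : ∀ e k → suc k < p ^ suc e → Z (powℚ P e ⊗ u k)
  Z-powP⊗u e k k<pᵉ with p ∣? suc k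
  Z-powP⊗u e       k k<pᵉ | no  p∤k = Z-⊗ (Z-pow Z-P e) (Z-u p∤k)
  Z-powP⊗u zero    k k<pᵉ | yes p∣k = contradiction p∣k (p∤< (subst (suc k <_) (ℕP.*-identityʳ p) k<pᵉ))
  Z-powP⊗u (suc e) k k<pᵉ | yes (divides (suc q) k≡q*p) = subst Z eq (Z-powP⊗u e q q<pᵉ)
    where
    q<pᵉ : suc q < p ^ suc e
    q<pᵉ = ℕP.*-cancelˡ-< p (suc q) (p ^ suc e) (subst (_< p ^ suc (suc e)) (trans k≡q*p (ℕP.*-comm (suc q) p)) k<pᵉ)
    swap : ∀ n p u → n ⊗ (p ⊗ u) ≡ n ⊗ p ⊗ u
    swap = solve-∀ ringℚ
    uq : u q ≡ P ⊗ u k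
    uq = ν-cancel q (begin
      ν (suc q) ⊗ u q           ≡⟨ ν-u q ⟩
      1ℚ                        ≡⟨ ν-u k ⟨
      ν (suc k) ⊗ u k           ≡⟨ cong (λ n → ν n ⊗ u k) k≡q*p ⟩
      ν (suc q * p) ⊗ u k       ≡⟨ cong (_⊗ u k) (ν-* (suc q) p) ⟩
      ν (suc q) ⊗ P ⊗ u k       ≡⟨ swap (ν (suc q)) P (u k) ⟨
      ν (suc q) ⊗ (P ⊗ u k)     ∎)
    ring : ∀ x p u → x ⊗ (p ⊗ u) ≡ p ⊗ x ⊗ u
    ring = solve-∀ ringℚ
    eq : powℚ P e ⊗ u q ≡ powℚ P (suc e) ⊗ u k
    eq = trans (cong (powℚ P e ⊗_) uq) (ring (powℚ P e) P (u k))

  -- The 4 is 3 + 1, for the denominators e + j + 1 with e ≤ 3 in `D-g`. Each step of the induction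
  -- at least doubles the right side.
  j+4<p^[1+j] : ∀ j → j ℕ.+ 4 < p ^ suc j
  j+4<p^[1+j] zero    = subst (4 <_) (sym (ℕP.*-identityʳ p)) (ℕP.≤-trans (s≤s (s≤s (s≤s (s≤s (s≤s z≤n))))) 7≤p)
  j+4<p^[1+j] (suc j) = ℕP.≤-trans (s≤s (j+4<p^[1+j] j)) (ℕP.≤-trans (ℕP.+-monoˡ-≤ x (ℕP.≤-trans (s≤s z≤n) (j+4<p^[1+j] j)))
    (subst (_≤ p * x) (cong (x ℕ.+_) (ℕP.+-identityʳ x)) (ℕP.*-monoˡ-≤ x (ℕP.≤-trans (s≤s (s≤s z≤n)) 7≤p))))
    where
    x = p ^ suc j

  -- The factor of p B_k in Faulhaber's formula is C(m,k) g (m - k).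
  g : ℕ → ℚ
  g i = powℚ P i ⊗ u i

  -- Write i = e + j. Then p^i/(i+1) is p^e times p^j/(e+j+1), and e + j + 1 < p^(j+1) has valuation
  -- at most j.
  D-g : ∀ {e i} → e ≤ 3 → e ≤ i → D e (g i)
  D-g {e} {i} e≤3 e≤i = subst (λ k → D e (g k)) (ℕP.m+[n∸m]≡n e≤i)
    (mkD (powℚ P j ⊗ u (e ℕ.+ j)) (Z-powP⊗u j (e ℕ.+ j) lt)
      (trans (cong (_⊗ u (e ℕ.+ j)) (pow-+ P e j)) (ℚP.*-assoc (powℚ P e) (powℚ P j) (u (e ℕ.+ j)))))
    where
    j = i ∸ e
    lt : suc (e ℕ.+ j) < p ^ suc j
    lt = ℕP.≤-<-trans (subst (suc (e ℕ.+ j) ≤_) (ℕP.+-comm 4 j) (ℕP.+-monoˡ-≤ j (s≤s e≤3))) (j+4<p^[1+j] j)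

  Z-g : ∀ i → Z (g i)
  Z-g i = D⇒Z (D-g {0} {i} z≤n z≤n)

  -- Integrality of p B_m, and power sums modulo p.

  B : ℕ → ℚ
  B = bernoulli

  -- For m < p - 1 the recurrence divides only by integers below p. `n` bounds a strong induction.
  Z-B-below : ∀ n m → m < n → suc m < p → Z (B m)
  Z-B-below (suc n) zero    _         _   = Z-1
  Z-B-below (suc n) (suc m) (s≤s m<n) m<p = subst Z (sym (bernoulli-suc m)) (Z-⊝ (Z-⊗ (Z-u (p∤< m<p))
    (Z-∑ (suc m) (λ k k<1+m → Z-⊗ (Z-ν (suc (suc m) C k))
      (Z-B-below n k (ℕP.<-≤-trans k<1+m m<n) (ℕP.<-trans (s≤s k<1+m) m<p))))))

  S-mod : ∀ {e} m → (∀ k → k < m → D e ((P ⊗ B k) ⊗ g (m ∸ k))) → Cong e (S p m) (P ⊗ B m)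
  S-mod {e} m d = mkCong (subst (D e) (sym eq) (D-∑ m (λ k k<m → Z-D (Z-ν (m C k)) (d k k<m))))
    where
    R = ∑ m (λ k → ν (m C k) ⊗ ((P ⊗ B k) ⊗ g (m ∸ k)))
    ring : ∀ a r → a ⊕ r ⊕ ⊝ a ≡ r
    ring = solve-∀ ringℚ
    eq : S p m ⊕ ⊝ (P ⊗ B m) ≡ R
    eq = trans (cong (_⊕ ⊝ (P ⊗ B m)) (faulhaber p m)) (ring (P ⊗ B m) R)

  Z-S : ∀ m → Z (S p m)
  Z-S m = Z-∑ p (λ k _ → Z-pow (Z-ν k) m)

  -- A weak form of the von Staudt-Clausen theorem: Faulhaber's formula expresses p B_m through an
  -- integer power sum and the p B_k with k < m, whose factors are p-integral.
  Z-P⊗B-below : ∀ n m → m < n → Z (P ⊗ B m)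
  -- Congruence modulo p^0 says that the difference lies in `Z`.
  Z-P⊗B-below (suc n) m (s≤s m≤n) = D⇒Z {0} (D-Congʳ
    (S-mod m (λ k k<m → Z⇒D (Z-⊗ (Z-P⊗B-below n k (ℕP.<-≤-trans k<m m≤n)) (Z-g (m ∸ k))))) (Z⇒D (Z-S m)))

  Z-P⊗B : ∀ m → Z (P ⊗ B m)
  Z-P⊗B m = Z-P⊗B-below (suc m) m (ℕP.n<1+n m)

  -- Every value of `g` at a positive index is divisible by p.
  S≡PB-mod-p : ∀ m → Cong 1 (S p m) (P ⊗ B m)
  S≡PB-mod-p m = S-mod m (λ k k<m → Z-D (Z-P⊗B k) (D-g (s≤s z≤n) (ℕP.m<n⇒0<n∸m k<m)))

  -- Fermat, Euler, and reciprocals as powers.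

  fermat : ∀ a → Cong 1 (powℚ (ν a) p) (ν a)
  fermat zero    = subst₂ (Cong 1) (trans (sym (pow-0 h)) (cong (λ z → powℚ z p) (sym ν-0))) (sym ν-0) Cong-refl
  fermat (suc a) = mkCong (subst (D 1) (sym eq) (D-⊕ (D-diff (fermat a)) mid))
    where
    t : ℕ → ℚ
    t k = ν (p C k) ⊗ (powℚ (ν a) k ⊗ powℚ 1ℚ (p ∸ k))
    M = ∑ h (t ∘ suc)
    -- The inner binomial coefficients of (a + 1)^p are divisible by p; the outer terms are 1 and
    -- a^p.
    mid : D 1 M
    mid = D-∑ h (λ k k<h → D-Z (∣⇒D-ι {1} (+ (p C suc k)) (subst (_∣ p C suc k) (sym (ℕP.*-identityʳ p)) (p∣C k (s≤s k<h))))
                              (Z-⊗ (Z-pow (Z-ν a) (suc k)) (Z-pow Z-1 (h ∸ k))))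
    t0 : t 0 ≡ 1ℚ
    t0 = cong₂ (λ c x → c ⊗ (1ℚ ⊗ x)) (trans (cong ν (nC0≡1 p)) ν-1) (pow-1 p)
    tp : t p ≡ powℚ (ν a) p
    tp = trans (cong₂ (λ c i → c ⊗ (powℚ (ν a) p ⊗ powℚ 1ℚ i)) (trans (cong ν (nCn≡1 p)) ν-1) (ℕP.n∸n≡0 p))
      (ring (powℚ (ν a) p))
      where
      ring : ∀ x → 1ℚ ⊗ (x ⊗ 1ℚ) ≡ x
      ring = solve-∀ ringℚ
    ring : ∀ m x a → 1ℚ ⊕ m ⊕ x ⊕ ⊝ (1ℚ ⊕ a) ≡ x ⊕ ⊝ a ⊕ m
    ring = solve-∀ ringℚ
    eq : powℚ (ν (suc a)) p ⊕ ⊝ ν (suc a) ≡ powℚ (ν a) p ⊕ ⊝ ν a ⊕ M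
    eq = begin
      powℚ (ν (suc a)) p ⊕ ⊝ ν (suc a)
        ≡⟨ cong (λ x → powℚ x p ⊕ ⊝ x) (ν-suc a) ⟩
      powℚ (1ℚ ⊕ ν a) p ⊕ ⊝ (1ℚ ⊕ ν a)
        ≡⟨ cong (λ x → powℚ x p ⊕ ⊝ (1ℚ ⊕ ν a)) (ℚP.+-comm 1ℚ (ν a)) ⟩
      powℚ (ν a ⊕ 1ℚ) p ⊕ ⊝ (1ℚ ⊕ ν a)
        ≡⟨ cong (_⊕ ⊝ (1ℚ ⊕ ν a)) (trans (sym (pow-⋆ (ν a) 1ℚ p)) (⋆-C (powℚ (ν a)) (powℚ 1ℚ) p)) ⟩
      ∑ p t ⊕ t p ⊕ ⊝ (1ℚ ⊕ ν a)
        ≡⟨ cong₂ (λ s x → s ⊕ x ⊕ ⊝ (1ℚ ⊕ ν a)) (trans (∑-suc h t) (cong (_⊕ M) t0)) tp ⟩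
      1ℚ ⊕ M ⊕ powℚ (ν a) p ⊕ ⊝ (1ℚ ⊕ ν a)
        ≡⟨ ring M (powℚ (ν a) p) (ν a) ⟩
      powℚ (ν a) p ⊕ ⊝ ν a ⊕ M
        ∎

  fermat-unit : ∀ k → suc k < p → Cong 1 (powℚ (ν (suc k)) h) 1ℚ
  fermat-unit k k<p = mkCong (D-cancel-unit k (p∤< k<p) (subst (D 1) (ring (ν (suc k)) (powℚ (ν (suc k)) h)) (D-diff (fermat (suc k)))))
    where
    ring : ∀ a x → a ⊗ x ⊕ ⊝ a ≡ a ⊗ (x ⊕ ⊝ 1ℚ)
    ring = solve-∀ ringℚ

  -- Euler's totient of p³.
  φ : ℕ
  φ = p * (p * h)

  -- Raising Fermat's congruence to the p-th power twice lifts the modulus from p to p² and then to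
  -- p³.
  euler : ∀ k → suc k < p → Cong 3 (powℚ (ν (suc k)) φ) 1ℚ
  euler k k<p = subst (λ z → Cong 3 z 1ℚ) (sym (trans (pow-* a p (p * h)) (cong (λ z → powℚ z p) (pow-* a p h))))
    (Cong-pow-p (Cong-pow-p (fermat-unit k k<p)))
    where
    a = ν (suc k)

  ν-u-pow : ∀ k r → powℚ (ν (suc k)) r ⊗ powℚ (u k) r ≡ 1ℚ
  ν-u-pow k r = trans (sym (pow-⊗ (ν (suc k)) (u k) r)) (trans (cong (λ z → powℚ z r) (ν-u k)) (pow-1 r))

  -- K^(m+1) ≡ K^(-r) once K^(m+1+r) ≡ 1. The exponent m + 1 is positive, so the power of 0 in the
  -- power sum vanishes.
  S-H : ∀ {e} m r → (∀ k → suc k < p → Cong e (powℚ (ν (suc k)) (suc m ℕ.+ r)) 1ℚ) → Cong e (S p (suc m)) (H r h)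
  S-H {e} m r d = mkCong (subst (D e) (sym eq) (D-∑ h (λ k k<h →
    subst (D e) (sym (eqₖ k)) (D-Z (D-diff (d k (s≤s k<h))) (Z-pow (Z-u (p∤< (s≤s k<h))) r)))))
    where
    t : ℕ → ℚ
    t k = powℚ (ν (suc k)) (suc m)
    eqₖ : ∀ k → t k ⊕ ⊝ powℚ (u k) r ≡ (powℚ (ν (suc k)) (suc m ℕ.+ r) ⊕ ⊝ 1ℚ) ⊗ powℚ (u k) r
    eqₖ k = begin
      t k ⊕ ⊝ w                                  ≡⟨ ring₁ (t k) w ⟩
      t k ⊗ 1ℚ ⊕ ⊝ w                             ≡⟨ cong (λ z → t k ⊗ z ⊕ ⊝ w) (ν-u-pow k r) ⟨
      t k ⊗ (x ⊗ w) ⊕ ⊝ w                        ≡⟨ ring₂ (t k) x w ⟩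
      (t k ⊗ x ⊕ ⊝ 1ℚ) ⊗ w                       ≡⟨ cong (λ z → (z ⊕ ⊝ 1ℚ) ⊗ w) (pow-+ (ν (suc k)) (suc m) r) ⟨
      (powℚ (ν (suc k)) (suc m ℕ.+ r) ⊕ ⊝ 1ℚ) ⊗ w  ∎
      where
      w = powℚ (u k) r
      x = powℚ (ν (suc k)) r
      ring₁ : ∀ t w → t ⊕ ⊝ w ≡ t ⊗ 1ℚ ⊕ ⊝ w
      ring₁ = solve-∀ ringℚ
      ring₂ : ∀ t x w → t ⊗ (x ⊗ w) ⊕ ⊝ w ≡ (t ⊗ x ⊕ ⊝ 1ℚ) ⊗ w
      ring₂ = solve-∀ ringℚ
    eq : S p (suc m) ⊕ ⊝ H r h ≡ ∑ h (λ k → t k ⊕ ⊝ powℚ (u k) r)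
    eq = begin
      S p (suc m) ⊕ ⊝ H r h
        ≡⟨ cong₂ (λ s x → s ⊕ ⊝ x) (∑-suc h (λ k → powℚ (ν k) (suc m))) (H-∑ r h) ⟩
      powℚ (ν 0) (suc m) ⊕ ∑ h t ⊕ ⊝ ∑ h (λ k → powℚ (u k) r)
        ≡⟨ cong₂ (λ z s → z ⊕ ∑ h t ⊕ s) (trans (cong (λ z → powℚ z (suc m)) ν-0) (pow-0 m)) (sym (∑-⊝ h (λ k → powℚ (u k) r))) ⟩
      0ℚ ⊕ ∑ h t ⊕ ∑ h (λ k → ⊝ powℚ (u k) r)
        ≡⟨ cong (_⊕ ∑ h (λ k → ⊝ powℚ (u k) r)) (ℚP.+-identityˡ (∑ h t)) ⟩
      ∑ h t ⊕ ∑ h (λ k → ⊝ powℚ (u k) r)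
        ≡⟨ ∑-⊕ h t (λ k → ⊝ powℚ (u k) r) ⟨
      ∑ h (λ k → t k ⊕ ⊝ powℚ (u k) r)
        ∎

  -- By Fermat the sum is congruent to `S p (suc m)` modulo p, hence to p B_(m+1). As r + 1 is
  -- positive, m + 1 < p - 1 and B_(m+1) is p-integral.
  D1-H : ∀ m r → suc m ℕ.+ suc r ≡ h → D 1 (H (suc r) h)
  D1-H m r eq = D-Congʳ (S-H m (suc r) (λ k k<p → subst (λ i → Cong 1 (powℚ (ν (suc k)) i) 1ℚ) (sym eq) (fermat-unit k k<p)))
    (D-Congˡ (S≡PB-mod-p (suc m)) (D-P⊗ (Z⇒D (Z-B-below (suc (suc m)) (suc m) (ℕP.n<1+n (suc m)) (s≤s lt)))))
    where
    lt : suc m < h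
    lt = subst (suc m <_) eq (subst (suc (suc m) ≤_) (sym (ℕP.+-suc (suc m) r)) (s≤s (ℕP.m≤m+n (suc m) r)))

  -- By p - 1 = 6 + w, the exponents p - 3 = 4 + w and p - 5 = 2 + w that match `H 2` and `H 4` are
  -- visibly positive.
  w : ℕ
  w = h ∸ 6

  6+w≡h : 6 ℕ.+ w ≡ h
  6+w≡h = ℕP.m+[n∸m]≡n (ℕP.≤-pred 7≤p)

  D1-H₂ : D 1 (H 2 h)
  D1-H₂ = D1-H (3 ℕ.+ w) 1 (trans (ℕP.+-comm (4 ℕ.+ w) 2) 6+w≡h)

  D1-H₄ : D 1 (H 4 h)
  D1-H₄ = D1-H (1 ℕ.+ w) 3 (trans (ℕP.+-comm (2 ℕ.+ w) 4) 6+w≡h)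

  -- Pairing K with p - K in the sums of reciprocals.

  D-double : ∀ {e x} → D e (x ⊕ x) → D e x
  D-double {e} {x} d = D-cancel-unit 1 (p∤< (ℕP.≤-trans (s≤s (s≤s (s≤s z≤n))) 7≤p)) (subst (D e) (sym eq) d)
    where
    ring : ∀ x → (1ℚ ⊕ (1ℚ ⊕ 0ℚ)) ⊗ x ≡ x ⊕ x
    ring = solve-∀ ringℚ
    eq : ν 2 ⊗ x ≡ x ⊕ x
    eq = trans (cong (_⊗ x) (trans (ν-suc 1) (cong (1ℚ ⊕_) (trans (ν-suc 0) (cong (1ℚ ⊕_) ν-0))))) (ring x)

  Z-uk : ∀ {k} → k < h → Z (u k)
  Z-uk k<h = Z-u (p∤< (s≤s k<h))

  -- With K = k + 1 and u k = 1/K, v k = 1/(p - K).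
  v : ℕ → ℚ
  v k = u (h ∸ suc k)

  Z-v : ∀ {k} → k < h → Z (v k)
  Z-v {k} k<h = Z-uk (ℕP.∸-monoʳ-< (s≤s z≤n) k<h)

  u⊕v : ∀ k → k < h → u k ⊕ v k ≡ P ⊗ (u k ⊗ v k)
  u⊕v k k<h = begin
    u k ⊕ v k                                    ≡⟨ ring₁ (u k) (v k) ⟩
    1ℚ ⊗ u k ⊕ 1ℚ ⊗ v k                          ≡⟨ cong₂ (λ s t → s ⊗ u k ⊕ t ⊗ v k) (ν-u (h ∸ suc k)) (ν-u k) ⟨
    b ⊗ v k ⊗ u k ⊕ a ⊗ u k ⊗ v k                ≡⟨ ring₂ a b (u k) (v k) ⟩
    (b ⊕ a) ⊗ (u k ⊗ v k)                        ≡⟨ cong (_⊗ (u k ⊗ v k)) (trans (sym (ν-+ (suc (h ∸ suc k)) (suc k))) (cong ν (cong suc (ℕP.m∸n+n≡m k<h)))) ⟩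
    P ⊗ (u k ⊗ v k)                              ∎
    where
    a = ν (suc k)
    b = ν (suc (h ∸ suc k))
    ring₁ : ∀ x y → x ⊕ y ≡ 1ℚ ⊗ x ⊕ 1ℚ ⊗ y
    ring₁ = solve-∀ ringℚ
    ring₂ : ∀ a b x y → b ⊗ y ⊗ x ⊕ a ⊗ x ⊗ y ≡ (b ⊕ a) ⊗ (x ⊗ y)
    ring₂ = solve-∀ ringℚ

  H⊕H : ∀ r → H r h ⊕ H r h ≡ ∑ h (λ k → powℚ (u k) r ⊕ powℚ (v k) r)
  H⊕H r = begin
    H r h ⊕ H r h                                                 ≡⟨ cong₂ _⊕_ (H-∑ r h) (trans (H-∑ r h) (∑-reverse h (λ k → powℚ (u k) r))) ⟩
    ∑ h (λ k → powℚ (u k) r) ⊕ ∑ h (λ k → powℚ (v k) r)           ≡⟨ ∑-⊕ h _ (λ k → powℚ (v k) r) ⟨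
    ∑ h (λ k → powℚ (u k) r ⊕ powℚ (v k) r)                       ∎

  Z-3 : Z (1ℚ ⊕ 1ℚ ⊕ 1ℚ)
  Z-3 = Z-⊕ (Z-⊕ Z-1 Z-1) Z-1

  D2-PP : D 2 (P ⊗ P)
  D2-PP = D-⊗ D-P D-P

  -- Doubling pairs K with p - K, and `cube-sum` gives -3 p H 4 plus a multiple of p²; `H 4`
  -- supplies the second factor p.
  D2-H₃ : D 2 (H 3 h)
  D2-H₃ = D-double (subst (D 2) (sym eq) (D-⊕ (D-⊗ (Z-D (Z-⊝ Z-3) D-P) D1-H₄) (D-Z D2-PP (Z-∑ h Z-W))))
    where
    W : ℕ → ℚ
    W k = (1ℚ ⊕ 1ℚ ⊕ 1ℚ) ⊗ u k ⊗ (u k ⊗ v k) ⊗ (u k ⊗ u k ⊕ ⊝ (u k ⊗ v k)) ⊕ P ⊗ (u k ⊗ v k) ⊗ (u k ⊗ v k) ⊗ (u k ⊗ v k)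
    Z-W : ∀ k → k < h → Z (W k)
    Z-W k k<h = Z-⊕ (Z-⊗ (Z-⊗ (Z-⊗ Z-3 zu) zw) (Z-⊕ (Z-⊗ zu zu) (Z-⊝ zw))) (Z-⊗ (Z-⊗ (Z-⊗ Z-P zw) zw) zw)
      where
      zu = Z-uk k<h
      zw = Z-⊗ zu (Z-v k<h)
    eq : H 3 h ⊕ H 3 h ≡ ⊝ (1ℚ ⊕ 1ℚ ⊕ 1ℚ) ⊗ P ⊗ H 4 h ⊕ P ⊗ P ⊗ ∑ h W
    eq = begin
      H 3 h ⊕ H 3 h
        ≡⟨ H⊕H 3 ⟩
      ∑ h (λ k → powℚ (u k) 3 ⊕ powℚ (v k) 3)
        ≡⟨ ∑-cong h (λ k k<h → cube-sum {u k} {v k} {u k ⊗ v k} {P} (u⊕v k k<h) refl) ⟩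
      ∑ h (λ k → ⊝ (1ℚ ⊕ 1ℚ ⊕ 1ℚ) ⊗ P ⊗ powℚ (u k) 4 ⊕ P ⊗ P ⊗ W k)
        ≡⟨ ∑-linear₂ h (⊝ (1ℚ ⊕ 1ℚ ⊕ 1ℚ) ⊗ P) (P ⊗ P) (λ k → powℚ (u k) 4) W ⟩
      ⊝ (1ℚ ⊕ 1ℚ ⊕ 1ℚ) ⊗ P ⊗ ∑ h (λ k → powℚ (u k) 4) ⊕ P ⊗ P ⊗ ∑ h W
        ≡⟨ cong (λ s → ⊝ (1ℚ ⊕ 1ℚ ⊕ 1ℚ) ⊗ P ⊗ s ⊕ P ⊗ P ⊗ ∑ h W) (H-∑ 4 h) ⟨
      ⊝ (1ℚ ⊕ 1ℚ ⊕ 1ℚ) ⊗ P ⊗ H 4 h ⊕ P ⊗ P ⊗ ∑ h W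
        ∎

  H₁⊕H₁≡⊝PH₂ : Cong 4 (H 1 h ⊕ H 1 h) (⊝ P ⊗ H 2 h)
  H₁⊕H₁≡⊝PH₂ = mkCong (subst (D 4) (sym (trans (cong (_⊕ ⊝ (⊝ P ⊗ H 2 h)) eq) (ring (⊝ P ⊗ H 2 h) _)))
    -- Up to sign, the terms beyond -p H 2 are p² H 3, p³ H 4 and p^4 times an integral sum, all in
    -- p^4 Z.
    (D-⊗ (D-⊝ D2-PP) (D-⊕ (Z-D Z-1 D2-H₃) (D-P⊗ (D-⊕ (Z-D Z-1 D1-H₄) (D-Z (D-⊝ D-P) (Z-∑ h Z-X)))))))
    where
    X Y T : ℕ → ℚ
    X k = powℚ (u k) 4 ⊗ v k
    -- The coefficients `1ℚ` bring the summands into the shape of `∑-linear₂`.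
    Y k = 1ℚ ⊗ powℚ (u k) 4 ⊕ ⊝ P ⊗ X k
    T k = 1ℚ ⊗ powℚ (u k) 3 ⊕ P ⊗ Y k
    Z-X : ∀ k → k < h → Z (X k)
    Z-X k k<h = Z-⊗ (Z-pow (Z-uk k<h) 4) (Z-v k<h)
    ring : ∀ a x → a ⊕ x ⊕ ⊝ a ≡ x
    ring = solve-∀ ringℚ
    eqY : ∑ h Y ≡ 1ℚ ⊗ H 4 h ⊕ ⊝ P ⊗ ∑ h X
    eqY = trans (∑-linear₂ h 1ℚ (⊝ P) (λ k → powℚ (u k) 4) X) (cong (λ s → 1ℚ ⊗ s ⊕ ⊝ P ⊗ ∑ h X) (sym (H-∑ 4 h)))
    eqT : ∑ h T ≡ 1ℚ ⊗ H 3 h ⊕ P ⊗ (1ℚ ⊗ H 4 h ⊕ ⊝ P ⊗ ∑ h X)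
    eqT = trans (∑-linear₂ h 1ℚ P (λ k → powℚ (u k) 3) Y) (cong₂ (λ s t → 1ℚ ⊗ s ⊕ P ⊗ t) (sym (H-∑ 3 h)) eqY)
    eq : H 1 h ⊕ H 1 h ≡ ⊝ P ⊗ H 2 h ⊕ ⊝ (P ⊗ P) ⊗ (1ℚ ⊗ H 3 h ⊕ P ⊗ (1ℚ ⊗ H 4 h ⊕ ⊝ P ⊗ ∑ h X))
    eq = begin
      H 1 h ⊕ H 1 h
        ≡⟨ H⊕H 1 ⟩
      ∑ h (λ k → powℚ (u k) 1 ⊕ powℚ (v k) 1)
        ≡⟨ ∑-cong h (λ k k<h → sum-expansion {u k} {v k} {P} (u⊕v k k<h)) ⟩
      ∑ h (λ k → ⊝ P ⊗ powℚ (u k) 2 ⊕ ⊝ (P ⊗ P) ⊗ T k)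
        ≡⟨ ∑-linear₂ h (⊝ P) (⊝ (P ⊗ P)) (λ k → powℚ (u k) 2) T ⟩
      ⊝ P ⊗ ∑ h (λ k → powℚ (u k) 2) ⊕ ⊝ (P ⊗ P) ⊗ ∑ h T
        ≡⟨ cong₂ (λ s t → ⊝ P ⊗ s ⊕ ⊝ (P ⊗ P) ⊗ t) (sym (H-∑ 2 h)) eqT ⟩
      ⊝ P ⊗ H 2 h ⊕ ⊝ (P ⊗ P) ⊗ (1ℚ ⊗ H 3 h ⊕ P ⊗ (1ℚ ⊗ H 4 h ⊕ ⊝ P ⊗ ∑ h X))
        ∎

  H₁⇔H₂ : D 4 (H 1 h) ⇔ D 3 (H 2 h)
  H₁⇔H₂ = mk⇔ (λ d → D-cancel-neg-P (D-Congʳ H₁⊕H₁≡⊝PH₂ (D-⊕ d d))) (λ d → D-double (D-Congˡ H₁⊕H₁≡⊝PH₂ (D-⊗ (D-⊝ D-P) d)))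

  -- p B_(φ-2) modulo p³.

  -- φ - 2, φ - 3, φ - 4 are written 3 + q, 2 + q, 1 + q.
  q : ℕ
  q = φ ∸ 5

  5+q≡φ : 5 ℕ.+ q ≡ φ
  5+q≡φ = ℕP.m+[n∸m]≡n (ℕP.≤-trans (ℕP.≤-trans (ℕP.n≤1+n 5) (ℕP.≤-pred 7≤p))
    (ℕP.≤-trans (ℕP.m≤n*m h p) (ℕP.m≤n*m (p * h) p)))

  S≡H-mod-p³ : ∀ m r → suc m ℕ.+ r ≡ 5 ℕ.+ q → Cong 3 (S p (suc m)) (H r h)
  S≡H-mod-p³ m r eq = S-H m r (λ k k<p → subst (λ i → Cong 3 (powℚ (ν (suc k)) i) 1ℚ) (sym (trans eq 5+q≡φ)) (euler k k<p))

  D-g′ : ∀ {e} k m → e ≤ 3 → e ℕ.+ k ≤ m → D e (g (m ∸ k))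
  D-g′ {e} k m e≤3 le = D-g e≤3 (ℕP.m+n≤o⇒m≤o∸n e le)

  -- p B_(φ-4) ≡ S p (φ-4) ≡ H 4 modulo p.
  D1-PB : D 1 (P ⊗ B (1 ℕ.+ q))
  D1-PB = D-Congʳ (S≡PB-mod-p (1 ℕ.+ q)) (D-Congˡ (Cong-weaken (s≤s z≤n) (S≡H-mod-p³ q 4 (ℕP.+-comm (1 ℕ.+ q) 4))) D1-H₄)

  -- At k = φ - 4, `g 1` provides one factor p and p B_(φ-4) the other. For smaller k, `g` alone
  -- provides p².
  D2-PB : D 2 (P ⊗ B (2 ℕ.+ q))
  D2-PB = D-Congʳ (S-mod (2 ℕ.+ q) bound)
    (D-Congˡ (Cong-weaken (s≤s (s≤s z≤n)) (S≡H-mod-p³ (1 ℕ.+ q) 3 (ℕP.+-comm (2 ℕ.+ q) 3))) D2-H₃)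
    where
    bound : ∀ k → k < 2 ℕ.+ q → D 2 (P ⊗ B k ⊗ g (2 ℕ.+ q ∸ k))
    bound k k<m with ℕP.m<1+n⇒m<n∨m≡n k<m
    ... | inj₁ (s≤s k≤q) = Z-D (Z-P⊗B k) (D-g′ {2} k (2 ℕ.+ q) (s≤s (s≤s z≤n)) (s≤s (s≤s k≤q)))
    ... | inj₂ refl      = D-⊗ D1-PB (D-g′ {1} (1 ℕ.+ q) (2 ℕ.+ q) (s≤s z≤n) ℕP.≤-refl)

  -- At k = φ - 3 and k = φ - 4, `g 1` and `g 2` provide p and p²; `D2-PB` and `D1-PB` provide the
  -- rest. For smaller k, `g` alone provides p³.
  S≡PB-mod-p³ : Cong 3 (S p (3 ℕ.+ q)) (P ⊗ B (3 ℕ.+ q))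
  S≡PB-mod-p³ = S-mod (3 ℕ.+ q) bound
    where
    bound : ∀ k → k < 3 ℕ.+ q → D 3 (P ⊗ B k ⊗ g (3 ℕ.+ q ∸ k))
    bound k k<m with ℕP.m<1+n⇒m<n∨m≡n k<m
    ... | inj₂ refl = D-⊗ D2-PB (D-g′ {1} (2 ℕ.+ q) (3 ℕ.+ q) (s≤s z≤n) ℕP.≤-refl)
    ... | inj₁ k<m′ with ℕP.m<1+n⇒m<n∨m≡n k<m′
    ...   | inj₂ refl      = D-⊗ D1-PB (D-g′ {2} (1 ℕ.+ q) (3 ℕ.+ q) (s≤s (s≤s z≤n)) ℕP.≤-refl)
    ...   | inj₁ (s≤s k≤q) = Z-D (Z-P⊗B k) (D-g′ {3} k (3 ℕ.+ q) ℕP.≤-refl (s≤s (s≤s (s≤s k≤q))))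

  H₂≡PB : Cong 3 (H 2 h) (P ⊗ B (3 ℕ.+ q))
  H₂≡PB = Cong-trans (Cong-sym (S≡H-mod-p³ (2 ℕ.+ q) 2 (ℕP.+-comm (3 ℕ.+ q) 2))) S≡PB-mod-p³

  H₂⇔B : D 3 (H 2 h) ⇔ D 2 (B (3 ℕ.+ q))
  H₂⇔B = mk⇔ (λ d → D-cancel-P (D-Congʳ H₂≡PB d)) (λ d → D-Congˡ H₂≡PB (D-P⊗ d))

  -- The binomial coefficient C(2p-1,p-1), which is `∏₊`, modulo p^5.

  ∏₊ ∏₋ Q : ℚ
  ∏₊ = ∏ h (λ k → 1ℚ ⊕ P ⊗ u k)
  ∏₋ = ∏ h (λ k → 1ℚ ⊕ ⊝ (P ⊗ u k))
  Q  = ∏ h (λ k → 1ℚ ⊕ ⊝ (P ⊗ P) ⊗ powℚ (u k) 2)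

  Q≡ : Cong 5 Q (1ℚ ⊕ ⊝ (P ⊗ P) ⊗ H 2 h)
  Q≡ = go (∏-expand {⊝ (P ⊗ P)} {λ k → powℚ (u k) 2} h (Z-⊝ (Z-⊗ Z-P Z-P)) (λ k k<h → Z-pow (Z-uk k<h) 2))
    where
    x = ⊝ (P ⊗ P)
    sq : ∑ h (λ k → powℚ (u k) 2 ⊗ powℚ (u k) 2) ≡ H 4 h
    sq = trans (∑-cong h (λ k _ → sym (pow-+ (u k) 2 2))) (sym (H-∑ 4 h))
    s≡ : ∑ h (λ k → powℚ (u k) 2) ≡ H 2 h
    s≡ = sym (H-∑ 2 h)
    ring : ∀ a b c → a ⊕ b ⊕ c ⊕ ⊝ a ≡ b ⊕ c
    ring = solve-∀ ringℚ
    D2-x : D 2 x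
    D2-x = D-⊝ D2-PP
    go : _ → Cong 5 Q (1ℚ ⊕ x ⊗ H 2 h)
    go (e , r , ze , zr , eqe , eq∏) = mkCong (subst (D 5)
      (sym (trans (cong (_⊕ ⊝ (1ℚ ⊕ x ⊗ H 2 h)) (trans eq∏ (cong (λ s → 1ℚ ⊕ x ⊗ s ⊕ x ⊗ x ⊗ e ⊕ x ⊗ x ⊗ x ⊗ r) s≡)))
                  (ring (1ℚ ⊕ x ⊗ H 2 h) (x ⊗ x ⊗ e) (x ⊗ x ⊗ x ⊗ r))))
      -- As x = -p², x² e lies in p^5 Z because 2 e = (H 2)² - H 4 is divisible by p, and x³ r lies
      -- in p^6 Z.
      (D-⊕ (D-⊗ (D-⊗ D2-x D2-x) D1-e) (D-weaken (ℕP.n≤1+n 5) (D-Z (D-⊗ (D-⊗ D2-x D2-x) D2-x) zr))))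
      where
      D1-e : D 1 e
      D1-e = D-double (subst (D 1) (sym (trans eqe (cong₂ (λ s t → s ⊗ s ⊕ ⊝ t) s≡ sq))) (D-⊕ (D-Z D1-H₂ (D⇒Z D1-H₂)) (D-⊝ D1-H₄)))

  ∏₊⊗∏₋ : ∏₊ ⊗ ∏₋ ≡ Q
  ∏₊⊗∏₋ = trans (sym (∏-⊗ h (λ k → 1ℚ ⊕ P ⊗ u k) (λ k → 1ℚ ⊕ ⊝ (P ⊗ u k)))) (∏-cong h (λ k _ → ring P (u k)))
    where
    ring : ∀ p u → (1ℚ ⊕ p ⊗ u) ⊗ (1ℚ ⊕ ⊝ (p ⊗ u)) ≡ 1ℚ ⊕ ⊝ (p ⊗ p) ⊗ (u ⊗ (u ⊗ 1ℚ))
    ring = solve-∀ ringℚ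

  -- Reversal pairs the factors at K and p - K, and (1 - p u)(1 - p v) = 1 + p² u v - p (u + v) = 1
  -- by `u⊕v`.
  ∏₋⊗∏₋ : ∏₋ ⊗ ∏₋ ≡ 1ℚ
  ∏₋⊗∏₋ = begin
    ∏₋ ⊗ ∏₋                                                        ≡⟨ cong (∏₋ ⊗_) (∏-reverse h (λ k → 1ℚ ⊕ ⊝ (P ⊗ u k))) ⟩
    ∏₋ ⊗ ∏ h (λ k → 1ℚ ⊕ ⊝ (P ⊗ v k))                              ≡⟨ ∏-⊗ h (λ k → 1ℚ ⊕ ⊝ (P ⊗ u k)) (λ k → 1ℚ ⊕ ⊝ (P ⊗ v k)) ⟨
    ∏ h (λ k → (1ℚ ⊕ ⊝ (P ⊗ u k)) ⊗ (1ℚ ⊕ ⊝ (P ⊗ v k)))            ≡⟨ ∏-cong h eq ⟩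
    ∏ h (λ _ → 1ℚ)                                                 ≡⟨ ∏-1 h ⟩
    1ℚ                                                             ∎
    where
    ring₁ : ∀ p u v → (1ℚ ⊕ ⊝ (p ⊗ u)) ⊗ (1ℚ ⊕ ⊝ (p ⊗ v)) ≡ 1ℚ ⊕ p ⊗ (p ⊗ (u ⊗ v)) ⊕ ⊝ (p ⊗ (u ⊕ v))
    ring₁ = solve-∀ ringℚ
    ring₂ : ∀ x → 1ℚ ⊕ x ⊕ ⊝ x ≡ 1ℚ
    ring₂ = solve-∀ ringℚ
    eq : ∀ k → k < h → (1ℚ ⊕ ⊝ (P ⊗ u k)) ⊗ (1ℚ ⊕ ⊝ (P ⊗ v k)) ≡ 1ℚ
    eq k k<h = trans (ring₁ P (u k) (v k)) (trans
      (cong (λ z → 1ℚ ⊕ P ⊗ (P ⊗ (u k ⊗ v k)) ⊕ ⊝ (P ⊗ z)) (u⊕v k k<h)) (ring₂ (P ⊗ (P ⊗ (u k ⊗ v k)))))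

  -- 2 (x - 1) = -(x - 1)²
  sqrt-1-lift : ∀ {e x} → x ⊗ x ≡ 1ℚ → Cong e x 1ℚ → Cong (e ℕ.+ e) x 1ℚ
  sqrt-1-lift {e} {x} x²≡1 (mkCong d) = mkCong (D-double (subst (D (e ℕ.+ e)) eq (D-⊝ (D-⊗ d d))))
    where
    ring₁ : ∀ x → ⊝ ((x ⊕ ⊝ 1ℚ) ⊗ (x ⊕ ⊝ 1ℚ)) ≡ x ⊕ ⊝ 1ℚ ⊕ (x ⊕ ⊝ 1ℚ) ⊕ (1ℚ ⊕ ⊝ (x ⊗ x))
    ring₁ = solve-∀ ringℚ
    ring₂ : ∀ y → y ⊕ (1ℚ ⊕ ⊝ 1ℚ) ≡ y
    ring₂ = solve-∀ ringℚ
    eq : ⊝ ((x ⊕ ⊝ 1ℚ) ⊗ (x ⊕ ⊝ 1ℚ)) ≡ x ⊕ ⊝ 1ℚ ⊕ (x ⊕ ⊝ 1ℚ)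
    eq = trans (ring₁ x) (trans (cong (λ z → x ⊕ ⊝ 1ℚ ⊕ (x ⊕ ⊝ 1ℚ) ⊕ (1ℚ ⊕ ⊝ z)) x²≡1) (ring₂ (x ⊕ ⊝ 1ℚ ⊕ (x ⊕ ⊝ 1ℚ))))

  ∏₋≡1 : Cong 5 ∏₋ 1ℚ
  -- Each factor is 1 modulo p, and three liftings take the exponent from 1 to 8.
  ∏₋≡1 = Cong-weaken (ℕP.m≤m+n 5 3) (lift (lift (lift (∏-Cong-1 h factor))))
    where
    lift : ∀ {e} → Cong e ∏₋ 1ℚ → Cong (e ℕ.+ e) ∏₋ 1ℚ
    lift = sqrt-1-lift ∏₋⊗∏₋
    ring : ∀ x → ⊝ x ≡ 1ℚ ⊕ ⊝ x ⊕ ⊝ 1ℚ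
    ring = solve-∀ ringℚ
    factor : ∀ k → k < h → Cong 1 (1ℚ ⊕ ⊝ (P ⊗ u k)) 1ℚ
    factor k k<h = mkCong (subst (D 1) (ring (P ⊗ u k)) (D-⊝ (D-Z D-P (Z-uk k<h))))

  -- The congruence `∏₋≡1` is multiplied by `∏₊`, which is integral as a binomial coefficient; the
  -- product of `∏₊` and `∏₋` is `Q`.
  ∏₊≡ : Cong 5 ∏₊ (1ℚ ⊕ ⊝ (P ⊗ P) ⊗ H 2 h)
  ∏₊≡ = Cong-trans (Cong-sym (mkCong (subst (D 5) eq (Z-D Z-∏₊ (D-diff ∏₋≡1))))) Q≡
    where
    ring : ∀ x y → x ⊗ (y ⊕ ⊝ 1ℚ) ≡ x ⊗ y ⊕ ⊝ x
    ring = solve-∀ ringℚ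
    eq : ∏₊ ⊗ (∏₋ ⊕ ⊝ 1ℚ) ≡ Q ⊕ ⊝ ∏₊
    eq = trans (ring ∏₊ ∏₋) (cong (_⊕ ⊝ ∏₊) ∏₊⊗∏₋)
    Z-∏₊ : Z ∏₊
    Z-∏₊ = subst Z (C-∏ p h) (Z-ν ((p ℕ.+ h) C h))

  ∏₊⇔H₂ : D 5 (∏₊ ⊕ ⊝ 1ℚ) ⇔ D 3 (H 2 h)
  ∏₊⇔H₂ = mk⇔
    (λ d → D-cancel-P (D-cancel-neg-P (subst (D 5) (ring₁ P (H 2 h)) (D-Congʳ ∏₊-1≡ d))))
    (λ d → D-Congˡ ∏₊-1≡ (D-⊗ (D-⊝ D2-PP) d))
    where
    ring₁ : ∀ p x → ⊝ (p ⊗ p) ⊗ x ≡ ⊝ p ⊗ (p ⊗ x)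
    ring₁ = solve-∀ ringℚ
    ring₂ : ∀ x y → x ⊕ ⊝ (1ℚ ⊕ y) ≡ x ⊕ ⊝ 1ℚ ⊕ ⊝ y
    ring₂ = solve-∀ ringℚ
    ∏₊-1≡ : Cong 5 (∏₊ ⊕ ⊝ 1ℚ) (⊝ (P ⊗ P) ⊗ H 2 h)
    ∏₊-1≡ = mkCong (subst (D 5) (ring₂ ∏₊ (⊝ (P ⊗ P) ⊗ H 2 h)) (D-diff ∏₊≡))

  -- The four conditions in terms of `H 2`.

  binom-1 : ι ((+ ((2 * p ∸ 1) C h)) ℤ.- (+ 1)) ≡ ∏₊ ⊕ ⊝ 1ℚ
  binom-1 = trans (ι-+ (+ ((2 * p ∸ 1) C h)) (ℤ.- (+ 1))) (cong₂ _⊕_ eq (trans (ι-neg (+ 1)) (cong ⊝_ ν-1)))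
    where
    eq : ν ((2 * p ∸ 1) C h) ≡ ∏₊
    -- `2 * p ∸ 1` reduces to h + (p + 0), which is brought into the form p + h of `C-∏`.
    eq = trans (cong (λ n → ν (n C h)) (trans (cong (h ℕ.+_) (ℕP.+-identityʳ p)) (ℕP.+-comm h p))) (C-∏ p h)

  p³∸p²∸2≡ : p ^ 3 ∸ p ^ 2 ∸ 2 ≡ 3 ℕ.+ q
  p³∸p²∸2≡ = cong (_∸ 2) (trans eq (sym 5+q≡φ))
    where
    eq : p ^ 3 ∸ p ^ 2 ≡ φ
    eq = begin
      p * (p * (p * 1)) ∸ p * (p * 1)   ≡⟨ ℕP.*-distribˡ-∸ p (p * (p * 1)) (p * 1) ⟨
      p * (p * (p * 1) ∸ p * 1)          ≡⟨ cong (p *_) (ℕP.*-distribˡ-∸ p (p * 1) 1) ⟨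
      p * (p * (p * 1 ∸ 1))               ≡⟨ cong (λ n → p * (p * (n ∸ 1))) (ℕP.*-identityʳ p) ⟩
      p * (p * h)                          ∎

  a⇔H₂ : (p ^ 5 ∣ ∣ (+ ((2 * p ∸ 1) C h)) ℤ.- (+ 1) ∣) ⇔ D 3 (H 2 h)
  a⇔H₂ = ⇔.trans (∣⇔D-ι 5 _) (subst (λ x → D 5 x ⇔ D 3 (H 2 h)) (sym binom-1) ∏₊⇔H₂)

  b⇔H₂ : (p ^ 4 ∣ ∣ ↥ H 1 h ∣) ⇔ D 3 (H 2 h)
  b⇔H₂ = ⇔.trans (∣↥⇔D 3 (H 1 h)) H₁⇔H₂

  c⇔H₂ : (p ^ 3 ∣ ∣ ↥ H 2 h ∣) ⇔ D 3 (H 2 h)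
  c⇔H₂ = ∣↥⇔D 2 (H 2 h)

  d⇔H₂ : (p ^ 2 ∣ ∣ ↥ bernoulli (p ^ 3 ∸ p ^ 2 ∸ 2) ∣) ⇔ D 3 (H 2 h)
  d⇔H₂ = subst (λ n → (p ^ 2 ∣ ∣ ↥ bernoulli n ∣) ⇔ D 3 (H 2 h)) (sym p³∸p²∸2≡)
    (⇔.trans (∣↥⇔D 1 (B (3 ℕ.+ q))) (⇔.sym H₂⇔B))

theorem2 : (p : ℕ) → Prime p → 7 ≤ p →
    (((+ (p ^ 5)) ℤD.∣ ((+ ((2 * p ∸ 1) C (p ∸ 1))) ℤ.- (+ 1))) ⇔ ((p ^ 4) ∣ ∣ ↥ (H 1 (p ∸ 1)) ∣))
    × (((p ^ 4) ∣ ∣ ↥ (H 1 (p ∸ 1)) ∣) ⇔ ((p ^ 3) ∣ ∣ ↥ (H 2 (p ∸ 1)) ∣))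
    × (((p ^ 3) ∣ ∣ ↥ (H 2 (p ∸ 1)) ∣) ⇔ ((p ^ 2) ∣ ∣ ↥ (bernoulli (p ^ 3 ∸ p ^ 2 ∸ 2)) ∣))
theorem2 zero    isPrime 7≤p = contradiction isPrime ¬prime[0]
theorem2 (suc h) isPrime 7≤p = ⇔.trans a⇔H₂ (⇔.sym b⇔H₂) , ⇔.trans b⇔H₂ (⇔.sym c⇔H₂) , ⇔.trans c⇔H₂ (⇔.sym d⇔H₂)
  where
  open Wolstenholme h isPrime 7≤p
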